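{- Let $p$ be a prime with $p\equiv 3\pmod 4$ or $p\equiv 5\pmod{12}$. Let $K=\mathbb{Q}_p(\gamma)$, where $\gamma=\iota$ is a root of $x^2+1$ when $p\equiv 3\pmod 4$, and $\gamma=\omega$ is a root of $x^2+x+1$ when $p\equiv 5\pmod{12}$. Consider the continued fraction algorithm on $K$ whose partial quotients are elements of the form $b_0+b_1\gamma$ with $b_0,b_1\in\mathbb{Z}\left[\frac1p\right]\cap\left(-\frac p2,\frac p2\right)$. Then every $\alpha\in\mathbb{Q}(\gamma)$ has a finite continued fraction expansion.
   Context: Each $b\in\mathbb{Q}_p$ is written uniquely as $b=\sum_{j\ge n_0}a_jp^j$ with $a_j\in\{ -\frac{p-1}{2},\dots,0,\dots,\frac{p-1}{2}\}$, and $\lfloor b\rfloor_p=\sum_{n_0\le j\le 0}a_jp^j$ (which is $0$ if $|b|_p<1$). Every $\alpha\in K$ is uniquely $\alpha=b_0+b_1\gamma$ with $b_0,b_1\in\mathbb{Q}_p$, and $\lfloor\alpha\rfloor=\lfloor b_0\rfloor_p+\lfloor b_1\rfloor_p\gamma$. The continued fraction expansion of $\alpha\in K$ is generated by $\alpha_0=\alpha$, $c_n=\lfloor\alpha_n\rfloor$, $\alpha_{n+1}=(\alpha_n-\lfloor\alpha_n\rfloor)^{ -1}$, where the process stops at step $n$ if $\alpha_n=\lfloor\alpha_n\rfloor$. The expansion is finite if the process stops, i.e. $\alpha_n=\lfloor\alpha_n\rfloor$ for some $n\ge 0$. -}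

module Defs where

open import Algebra.Bundles using (CommutativeRing)
import Algebra.Properties.Semiring.Exp as SemiringExp
open import Data.Integer as ℤ using (ℤ; +_; -[1+_]; _⊖_)
import Data.Integer.Properties as ℤ
open import Data.Nat as ℕ using (ℕ; zero; suc; NonZero)
open import Data.Nat.Divisibility using (_∣_; _∤_; divides; _∣?_; ∣-trans; ∣1⇒≡1)
import Data.Nat.Divisibility as ∣
open import Data.Nat.Induction using (<-rec)
open import Data.Nat.Primality using (Prime; prime⇒nonZero; prime⇒nonTrivial; euclidsLemma)
import Data.Nat.Properties as ℕ
open import Data.Product using (∃; ∃₂; _×_; _,_)
open import Data.Rational as ℚ
  using (ℚ; 0ℚ; 1ℚ; _/_; ↥_; ↧_; ↧ₙ_; toℚᵘ)
import Data.Rational.Properties as ℚ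
open import Data.Rational.Solver using (module +-*-Solver)
open import Data.Rational.Unnormalised as ℚᵘ using (*≡*)
import Data.Rational.Unnormalised.Properties as ℚᵘ
open import Data.Sum using ([_,_]′)
open import Relation.Binary.PropositionalEquality
  using (_≡_; refl; sym; trans; cong; cong₂; subst)
open import Relation.Nullary using (¬_; yes; no)

module Padic (p : ℕ) (p-prime : Prime p) where

  instance
    p≢0 : NonZero p
    p≢0 = prime⇒nonZero p-prime

  open SemiringExp (CommutativeRing.semiring ℚ.+-*-commutativeRing)
    using (_^_; ^-homo-*)

  p^_ : ℤ → ℚ
  p^ (+ n)    = (+ p / 1) ^ n
  p^ -[1+ n ] = (+ 1 / p) ^ suc n

  -- |x|ₚ ≤ 1; the denominator ↧ₙ x is taken in lowest terms.
  record Integral (x : ℚ) : Set where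
    constructor p∤↧
    field
      p∤denominator : p ∤ ↧ₙ x

  -- |x|ₚ ≤ p^e; recall |p^e|ₚ = p^(-e).
  record ∣_∣ₚ≤p^_ (x : ℚ) (e : ℤ) : Set where
    constructor bound
    field
      integral : Integral (x ℚ.* p^ e)
  open ∣_∣ₚ≤p^_ public

  -- xₙ - yₙ tends to 0 in the p-adic absolute value.
  infix 4 _∼_
  record _∼_ (x y : ℕ → ℚ) : Set where
    constructor tends-to-0
    field
      close : ∀ (k : ℕ) → ∃ λ N → ∀ n → N ℕ.≤ n → ∣ x n ℚ.- y n ∣ₚ≤p^ (ℤ.- (+ k))

  Cauchy : (ℕ → ℚ) → Set
  Cauchy x = ∀ (k : ℕ) → ∃ λ N → ∀ m n → N ℕ.≤ m → N ℕ.≤ n →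
    ∣ x m ℚ.- x n ∣ₚ≤p^ (ℤ.- (+ k))

  p≢1 : ¬ p ≡ 1
  p≢1 = ℕ.nonTrivial⇒≢1 ⦃ prime⇒nonTrivial p-prime ⦄

  ↧ₙ-/-∣ : ∀ i d .{{_ : NonZero d}} → ↧ₙ (i / d) ∣ d
  ↧ₙ-/-∣ i d = divides ℤ.∣ g ∣ (sym (trans (ℕ.*-comm ℤ.∣ g ∣ (↧ₙ (i / d)))
      (trans (sym (ℤ.abs-* (↧ (i / d)) g)) (cong ℤ.∣_∣ (ℚ.↧-/ i d)))))
    where
    open import Data.Integer.GCD using () renaming (gcd to gcdℤ)
    g = gcdℤ i (+ d)

  integral-/ : ∀ i d .{{_ : NonZero d}} → p ∤ d → Integral (i / d)
  integral-/ i d p∤d = p∤↧ λ p∣ → p∤d (∣-trans p∣ (↧ₙ-/-∣ i d))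

  integral-+ : ∀ {x y} → Integral x → Integral y → Integral (x ℚ.+ y)
  integral-+ {x@record{}} {y@record{}} (p∤↧ ix) (p∤↧ iy) =
    integral-/ (↥ x ℤ.* ↧ y ℤ.+ ↥ y ℤ.* ↧ x) (↧ₙ x ℕ.* ↧ₙ y)
      (λ q → [ ix , iy ]′ (euclidsLemma (↧ₙ x) (↧ₙ y) p-prime q))

  integral-* : ∀ {x y} → Integral x → Integral y → Integral (x ℚ.* y)
  integral-* {x@record{}} {y@record{}} (p∤↧ ix) (p∤↧ iy) =
    integral-/ (↥ x ℤ.* ↥ y) (↧ₙ x ℕ.* ↧ₙ y)
      (λ q → [ ix , iy ]′ (euclidsLemma (↧ₙ x) (↧ₙ y) p-prime q))

  integral-0 : Integral 0ℚ
  integral-0 = p∤↧ λ q → p≢1 (∣1⇒≡1 q)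

  integral-1 : Integral 1ℚ
  integral-1 = p∤↧ λ q → p≢1 (∣1⇒≡1 q)

  integral-p : Integral (+ p / 1)
  integral-p = integral-/ (+ p) 1 (λ q → p≢1 (∣1⇒≡1 q))

  integral-p^ : ∀ n → Integral (p^ (+ n))
  integral-p^ zero    = integral-1
  integral-p^ (suc n) = integral-* integral-p (integral-p^ n)

  integral-neg : ∀ {x} → Integral x → Integral (ℚ.- x)
  integral-neg {x} (p∤↧ ix) = p∤↧ λ q → ix (subst (p ∣_) (cong ℤ.∣_∣ (ℚ.↧-neg x)) q)

  p⁻ : ℕ → ℚ
  p⁻ n = (+ 1 / p) ^ n

  p^-neg : ∀ n → p^ (ℤ.- (+ n)) ≡ p⁻ n
  p^-neg zero    = refl
  p^-neg (suc n) = refl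

  toℚᵘ-/ : ∀ i d .{{_ : NonZero d}} → toℚᵘ (i / d) ℚᵘ.≃ i ℚᵘ./ d
  toℚᵘ-/ i (suc d) = ℚ.toℚᵘ-fromℚᵘ (i ℚᵘ./ suc d)

  p*p⁻¹ : (+ p / 1) ℚ.* (+ 1 / p) ≡ 1ℚ
  p*p⁻¹ = ℚ.toℚᵘ-injective (ℚᵘ.≃-trans (ℚ.toℚᵘ-homo-* (+ p / 1) (+ 1 / p))
    (ℚᵘ.≃-trans (ℚᵘ.*-cong (toℚᵘ-/ (+ p) 1) (toℚᵘ-/ (+ 1) p)) (cross p)))
    where
    cross : ∀ q .{{_ : NonZero q}} → ((+ q) ℚᵘ./ 1) ℚᵘ.* ((+ 1) ℚᵘ./ q) ℚᵘ.≃ toℚᵘ 1ℚ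
    cross (suc q) = *≡* (trans (ℤ.*-identityʳ _) (trans (ℤ.*-identityʳ (+ suc q))
      (sym (trans (ℤ.*-identityˡ _) (cong +_ (ℕ.*-identityˡ (suc q)))))))

  open +-*-Solver

  *-interchange : ∀ a b c d → (a ℚ.* b) ℚ.* (c ℚ.* d) ≡ (a ℚ.* c) ℚ.* (b ℚ.* d)
  *-interchange = solve 4 (λ a b c d → (a :* b) :* (c :* d) := (a :* c) :* (b :* d)) refl

  p^*p⁻ : ∀ n → p^ (+ n) ℚ.* p⁻ n ≡ 1ℚ
  p^*p⁻ zero    = refl
  p^*p⁻ (suc n) = trans (*-interchange (+ p / 1) (p^ (+ n)) (+ 1 / p) (p⁻ n))
    (cong₂ ℚ._*_ p*p⁻¹ (p^*p⁻ n))

  p⁻-cancel : ∀ B k → p^ (+ B) ℚ.* p⁻ (B ℕ.+ k) ≡ p⁻ k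
  p⁻-cancel B k = trans (cong (p^ (+ B) ℚ.*_) (^-homo-* (+ 1 / p) B k))
    (trans (sym (ℚ.*-assoc (p^ (+ B)) (p⁻ B) (p⁻ k)))
      (trans (cong (ℚ._* p⁻ k) (p^*p⁻ B)) (ℚ.*-identityˡ (p⁻ k))))

  small-+ : ∀ {x y e} → ∣ x ∣ₚ≤p^ e → ∣ y ∣ₚ≤p^ e → ∣ x ℚ.+ y ∣ₚ≤p^ e
  small-+ {x} {y} {e} (bound sx) (bound sy) =
    bound (subst Integral (sym (ℚ.*-distribʳ-+ (p^ e) x y))
      (integral-+ sx sy))

  small-neg : ∀ {x e} → ∣ x ∣ₚ≤p^ e → ∣ ℚ.- x ∣ₚ≤p^ e
  small-neg {x} {e} (bound sx) =
    bound (subst Integral (ℚ.neg-distribˡ-* x (p^ e)) (integral-neg sx))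

  small-* : ∀ {x y} B k → ∣ x ∣ₚ≤p^ (+ B) → ∣ y ∣ₚ≤p^ (ℤ.- (+ (B ℕ.+ k))) →
            ∣ x ℚ.* y ∣ₚ≤p^ (ℤ.- (+ k))
  small-* {x} {y} B k (bound bx) (bound sy) =
    bound (subst Integral eq (integral-* bx sy))
    where
    eq : (x ℚ.* p^ (+ B)) ℚ.* (y ℚ.* p^ (ℤ.- (+ (B ℕ.+ k)))) ≡
         (x ℚ.* y) ℚ.* p^ (ℤ.- (+ k))
    eq = trans (*-interchange x (p^ (+ B)) y (p^ (ℤ.- (+ (B ℕ.+ k)))))
           (cong ((x ℚ.* y) ℚ.*_)
             (trans (cong (p^ (+ B) ℚ.*_) (p^-neg (B ℕ.+ k)))
               (trans (p⁻-cancel B k) (sym (p^-neg k)))))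

  small-0 : ∀ e → ∣ 0ℚ ∣ₚ≤p^ e
  small-0 e = bound (subst Integral (sym (ℚ.*-zeroˡ (p^ e))) integral-0)

  ↧ₙ-p* : ∀ x → p ∣ ↧ₙ x → ↧ₙ (x ℚ.* (+ p / 1)) ℕ.< ↧ₙ x
  ↧ₙ-p* x p∣d@(divides q d≡q*p) =
    ℕ.≤-<-trans (∣.∣⇒≤ ⦃ q≢0 ⦄ (subst (λ z → ↧ₙ z ∣ q) eq (↧ₙ-/-∣ (↥ x) q ⦃ q≢0 ⦄)))
      (subst (q ℕ.<_) (sym d≡q*p)
        (ℕ.m<m*n q p ⦃ q≢0 ⦄ (ℕ.nonTrivial⇒n>1 p ⦃ prime⇒nonTrivial p-prime ⦄)))
    where
    instance
      q≢0 : NonZero q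
      q≢0 = ℕ.≢-nonZero λ q≡0 → ℕ.1+n≢0 (trans d≡q*p (cong (ℕ._* p) q≡0))
    cross : ∀ (x : ℚ) q .{{_ : NonZero q}} → ↧ₙ x ≡ q ℕ.* p →
            (↥ x) ℚᵘ./ q ℚᵘ.≃ toℚᵘ x ℚᵘ.* ((+ p) ℚᵘ./ 1)
    cross x@record{} (suc q) e = *≡* (trans
      (cong (↥ x ℤ.*_) (trans (cong +_ (trans (ℕ.*-identityʳ _)
          (trans e (ℕ.*-comm (suc q) p)))) (ℤ.pos-* p (suc q))))
      (sym (ℤ.*-assoc (↥ x) (+ p) (+ suc q))))
    eq : ↥ x / q ≡ x ℚ.* (+ p / 1)
    eq = ℚ.toℚᵘ-injective (ℚᵘ.≃-trans (toℚᵘ-/ (↥ x) q)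
      (ℚᵘ.≃-trans (cross x q d≡q*p)
        (ℚᵘ.≃-sym (ℚᵘ.≃-trans (ℚ.toℚᵘ-homo-* x (+ p / 1))
          (ℚᵘ.*-cong {toℚᵘ x} ℚᵘ.≃-refl (toℚᵘ-/ (+ p) 1))))))

  bounded : ∀ x → ∃ λ B → ∣ x ∣ₚ≤p^ (+ B)
  bounded x = <-rec (λ d → ∀ x → ↧ₙ x ≡ d → ∃ λ B → ∣ x ∣ₚ≤p^ (+ B)) step (↧ₙ x) x refl
    where
    step : ∀ d → (∀ {d′} → d′ ℕ.< d → ∀ x → ↧ₙ x ≡ d′ → ∃ λ B → ∣ x ∣ₚ≤p^ (+ B)) →
           ∀ x → ↧ₙ x ≡ d → ∃ λ B → ∣ x ∣ₚ≤p^ (+ B)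
    step _ rec x refl with p ∣? ↧ₙ x
    ... | no p∤d = 0 , bound (subst Integral (sym (ℚ.*-identityʳ x)) (p∤↧ p∤d))
    ... | yes p∣d with rec (↧ₙ-p* x p∣d) (x ℚ.* (+ p / 1)) refl
    ...   | B , bound i = suc B , bound (subst Integral (ℚ.*-assoc x (+ p / 1) (p^ (+ B))) i)

  -+-cancel : ∀ a b → a ℚ.- b ℚ.+ b ≡ a
  -+-cancel = solve 2 (λ a b → a :- b :+ b := a) refl

  +-diff : ∀ a b c d → (a ℚ.- b) ℚ.+ (c ℚ.- d) ≡ (a ℚ.+ c) ℚ.- (b ℚ.+ d)
  +-diff = solve 4 (λ a b c d → (a :- b) :+ (c :- d) := (a :+ c) :- (b :+ d)) refl

  neg-diff : ∀ a b → ℚ.- (a ℚ.- b) ≡ (ℚ.- a) ℚ.- (ℚ.- b)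
  neg-diff = solve 2 (λ a b → :- (a :- b) := (:- a) :- (:- b)) refl

  *-diff : ∀ a b c d → a ℚ.* (c ℚ.- d) ℚ.+ d ℚ.* (a ℚ.- b) ≡ a ℚ.* c ℚ.- b ℚ.* d
  *-diff = solve 4 (λ a b c d → a :* (c :- d) :+ d :* (a :- b) := a :* c :- b :* d) refl

  -- Abstract because types mentioning ℚₚ arithmetic are slow to normalise otherwise.
  abstract
    cauchy-bounded : ∀ {x} → Cauchy x → ∃₂ λ N B → ∀ n → N ℕ.≤ n → ∣ x n ∣ₚ≤p^ (+ B)
    cauchy-bounded {x} cx =
      let N , close = cx 0
          B , bxN = bounded (x N)
      in N , B , λ n N≤n → subst (∣_∣ₚ≤p^ (+ B)) (-+-cancel (x n) (x N))
        (small-+ (weaken B (close n N N≤n ℕ.≤-refl)) bxN)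
      where
      weaken : ∀ {x} B → ∣ x ∣ₚ≤p^ (+ 0) → ∣ x ∣ₚ≤p^ (+ B)
      weaken {x} B (bound i) = bound (integral-*
        (subst Integral (ℚ.*-identityʳ x) i) (integral-p^ B))

    cauchy-const : ∀ x → Cauchy (λ _ → x)
    cauchy-const x k = 0 , λ _ _ _ _ →
      subst (∣_∣ₚ≤p^ (ℤ.- (+ k))) (sym (ℚ.+-inverseʳ x)) (small-0 (ℤ.- (+ k)))

    cauchy-+ : ∀ {x y} → Cauchy x → Cauchy y → Cauchy (λ n → x n ℚ.+ y n)
    cauchy-+ {x} {y} cx cy k =
      let M , f = cx k
          N , g = cy k
      in M ℕ.⊔ N , λ m n ≤m ≤n →
        subst (∣_∣ₚ≤p^ (ℤ.- (+ k))) (+-diff (x m) (x n) (y m) (y n))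
          (small-+ (f m n (ℕ.m⊔n≤o⇒m≤o M N ≤m) (ℕ.m⊔n≤o⇒m≤o M N ≤n))
                   (g m n (ℕ.m⊔n≤o⇒n≤o M N ≤m) (ℕ.m⊔n≤o⇒n≤o M N ≤n)))

    cauchy-neg : ∀ {x} → Cauchy x → Cauchy (λ n → ℚ.- x n)
    cauchy-neg {x} cx k =
      let N , f = cx k
      in N , λ m n N≤m N≤n → subst (∣_∣ₚ≤p^ (ℤ.- (+ k))) (neg-diff (x m) (x n))
        (small-neg (f m n N≤m N≤n))

    cauchy-* : ∀ {x y} → Cauchy x → Cauchy y → Cauchy (λ n → x n ℚ.* y n)
    cauchy-* {x} {y} cx cy k =
      let L , B , bx = cauchy-bounded {x} cx
          M , C , by = cauchy-bounded {y} cy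
          N , f = cy (B ℕ.+ k)
          O , g = cx (C ℕ.+ k)
          LM = L ℕ.⊔ M
          NO = N ℕ.⊔ O
      in LM ℕ.⊔ NO , λ m n ≤m ≤n →
        let LM≤m = ℕ.m⊔n≤o⇒m≤o LM NO ≤m
            LM≤n = ℕ.m⊔n≤o⇒m≤o LM NO ≤n
            NO≤m = ℕ.m⊔n≤o⇒n≤o LM NO ≤m
            NO≤n = ℕ.m⊔n≤o⇒n≤o LM NO ≤n
        in subst (∣_∣ₚ≤p^ (ℤ.- (+ k))) (*-diff (x m) (x n) (y m) (y n))
          (small-+
            (small-* B k (bx m (ℕ.m⊔n≤o⇒m≤o L M LM≤m))
              (f m n (ℕ.m⊔n≤o⇒m≤o N O NO≤m) (ℕ.m⊔n≤o⇒m≤o N O NO≤n)))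
            (small-* C k (by n (ℕ.m⊔n≤o⇒n≤o L M LM≤n))
              (g m n (ℕ.m⊔n≤o⇒n≤o N O NO≤m) (ℕ.m⊔n≤o⇒n≤o N O NO≤n))))

  -- The completion of ℚ for |·|ₚ, as a setoid.
  record ℚₚ : Set where
    constructor mkℚₚ
    field
      seq    : ℕ → ℚ
      cauchy : Cauchy seq
  open ℚₚ public

  infix 4 _≈ₚ_
  _≈ₚ_ : ℚₚ → ℚₚ → Set
  x ≈ₚ y = seq x ∼ seq y

  fromℚ : ℚ → ℚₚ
  fromℚ x = mkℚₚ (λ _ → x) (cauchy-const x)

  infixl 6 _+ₚ_ _-ₚ_
  infixl 7 _*ₚ_
  infix  8 -ₚ_

  _+ₚ_ _*ₚ_ : ℚₚ → ℚₚ → ℚₚ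
  x +ₚ y = mkℚₚ (λ n → seq x n ℚ.+ seq y n) (cauchy-+ {seq x} {seq y} (cauchy x) (cauchy y))
  x *ₚ y = mkℚₚ (λ n → seq x n ℚ.* seq y n) (cauchy-* {seq x} {seq y} (cauchy x) (cauchy y))

  -ₚ_ : ℚₚ → ℚₚ
  -ₚ x = mkℚₚ (λ n → ℚ.- seq x n) (cauchy-neg {seq x} (cauchy x))

  _-ₚ_ : ℚₚ → ℚₚ → ℚₚ
  x -ₚ y = x +ₚ (-ₚ y)

  -- The sum of a j * p^j over the n indices j = -N, -N+1, …, -N+(n-1).
  partialSum : ℕ → (ℤ → ℤ) → ℕ → ℚ
  partialSum N a zero    = 0ℚ
  partialSum N a (suc n) =
    partialSum N a n ℚ.+ (a (n ⊖ N) / 1) ℚ.* p^ (n ⊖ N)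

  -- b = Σ_{j ≥ -N} a j * p^j.  Starting at a nonpositive index is no
  -- restriction, since leading digits may be 0.
  record IsExpansion (b : ℚₚ) (N : ℕ) (a : ℤ → ℤ) : Set where
    field
      balanced  : ∀ j → ℤ.∣ a j ∣ ℕ.≤ (p ℕ.∸ 1) ℕ./ 2
      converges : partialSum N a ∼ seq b

  -- c = ⌊b⌋ₚ, the part of the expansion of b with exponents -N ≤ j ≤ 0.  A relation,
  -- functional because for odd p the balanced expansion of b is unique up to leading zeros.
  _isFloorₚOf_ : ℚ → ℚₚ → Set
  c isFloorₚOf b = ∃₂ λ N a → IsExpansion b N a × c ≡ partialSum N a (suc N)

-- ι is a root of x² + 1, and ω a root of x² + x + 1.
data Generator : Set where
  ι ω : Generator

data Admissible (p : ℕ) : Generator → Set where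
  p≡3[4]  : p ℕ.% 4  ≡ 3 → Admissible p ι
  p≡5[12] : p ℕ.% 12 ≡ 5 → Admissible p ω

module Extension (p : ℕ) (p-prime : Prime p) (γ : Generator) where

  open Padic p p-prime

  -- b₀ +γ b₁ stands for b₀ + b₁ γ.
  infix 5 _+γ_
  record K : Set where
    constructor _+γ_
    field
      b₀ b₁ : ℚₚ

  infix 4 _≈_ _∈ℚ[γ] _isFloorOf_ _↦_
  _≈_ : K → K → Set
  (a +γ b) ≈ (c +γ d) = a ≈ₚ c × b ≈ₚ d

  infixl 6 _-_
  _-_ : K → K → K
  (a +γ b) - (c +γ d) = (a -ₚ c) +γ (b -ₚ d)

  -- Reduced by ι² = -1, respectively ω² = -1 - ω.
  mul : Generator → K → K → K
  mul ι (a +γ b) (c +γ d) = (a *ₚ c -ₚ b *ₚ d) +γ (a *ₚ d +ₚ b *ₚ c)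
  mul ω (a +γ b) (c +γ d) = (a *ₚ c -ₚ b *ₚ d) +γ (a *ₚ d +ₚ b *ₚ c -ₚ b *ₚ d)

  infixl 7 _*_
  _*_ : K → K → K
  _*_ = mul γ

  fromℚ² : ℚ → ℚ → K
  fromℚ² x y = fromℚ x +γ fromℚ y

  1K : K
  1K = fromℚ² 1ℚ 0ℚ

  _∈ℚ[γ] : K → Set
  α ∈ℚ[γ] = ∃₂ λ x y → α ≈ fromℚ² x y

  data _isFloorOf_ : K → K → Set where
    floor : ∀ {b₀ b₁ c₀ c₁} → c₀ isFloorₚOf b₀ → c₁ isFloorₚOf b₁ →
            fromℚ² c₀ c₁ isFloorOf (b₀ +γ b₁)

  -- β = (α - ⌊α⌋)⁻¹.  The existence of such a β already forces α ≉ ⌊α⌋,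
  -- so that the process has not stopped at α.
  record _↦_ (α β : K) : Set where
    field
      ⌊α⌋     : K
      isFloor : ⌊α⌋ isFloorOf α
      inverse : β * (α - ⌊α⌋) ≈ 1K

  data FiniteExpansion (α : K) : Set where
    stop : ∀ ⌊α⌋ → ⌊α⌋ isFloorOf α → α ≈ ⌊α⌋ → FiniteExpansion α
    next : ∀ β → α ↦ β → FiniteExpansion β → FiniteExpansion α

{-# OPTIONS --safe #-}

-- Write a rational α as P / (p Q) with P and Q ≠ 0 in ℤ[γ], let c = ⌊α⌋ and α - c = p z.
-- Then R = z Q lies in ℤ[γ]: it is p-integral since z and Q are, and p² R = P - p c Q has only
-- powers of p in its denominators.  Either R = 0 and α = c, or the next complete quotient is
-- Q / (p R).  The coordinates of c are at most p / 2 in absolute value, so N(c / p) ≤ 3/4, and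
-- N(u - v) ≤ 7 N(u) + (7/6) N(v) gives N(R) ≤ (7/81) N(P) + (7/8) N(Q), using p ≥ 3.
-- Hence 10 N(Q) + N(P) strictly decreases along the expansion.
module Submission where

open import Defs
open import Data.Integer as ℤ using (ℤ; +_; _⊖_)
import Data.Integer.DivMod as ℤ
import Data.Integer.Divisibility.Signed as Signed
import Data.Integer.Properties as ℤ
open import Data.Integer.Solver using () renaming (module +-*-Solver to ℤ-Solver)
open import Data.Nat as ℕ using (ℕ; zero; suc; NonZero)
open import Data.Nat.Coprimality using (coprime-Bézout)
import Data.Nat.DivMod as ℕ
open import Data.Nat.Divisibility using (_∣_; _∤_; divides; ∣1⇒≡1)
open import Data.Nat.GCD using (module Bézout)
open import Data.Nat.Primality using (Prime; prime⇒irreducible; euclidsLemma)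
import Data.Nat.Properties as ℕ
open import Data.Nat.Solver using () renaming (module +-*-Solver to ℕ-Solver)
open import Data.Product using (∃; ∃₂; _×_; _,_; proj₁; proj₂)
open import Data.Rational as ℚ using (ℚ; 0ℚ; 1ℚ; _/_; ↥_; ↧ₙ_; toℚᵘ)
import Data.Rational.Properties as ℚ
open import Data.Rational.Solver using () renaming (module +-*-Solver to ℚ-Solver)
open import Data.Rational.Unnormalised as ℚᵘ using (mkℚᵘ; *≡*)
import Data.Rational.Unnormalised.Properties as ℚᵘ
open import Data.Sum using (inj₁; inj₂; [_,_]′)
open import Function using (id)
open import Relation.Binary.PropositionalEquality
  using (_≡_; refl; sym; trans; cong; cong₂; subst; subst₂; module ≡-Reasoning)
open import Relation.Nullary using (¬_; Dec; yes; no; contradiction)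
open import Relation.Nullary.Decidable using (_×-dec_)

-- The floor controls two unrelated sizes at once: `α - c` is divisible by p, and `c` is small in
-- the ordinary absolute value. Keeping the factor p outside `Q` makes both visible in R = P / p² -
-- (c / p) Q, where the first coefficient is at most 1/9 and the second has norm at most 3/4. The
-- value 3/4 is so close to 1 that the symmetric estimate N(u - v) ≤ 2 N(u) + 2 N(v) would yield 3/2
-- and no contraction. The weights 7 and 7/6 move the loss to the `P` term, where the factor 1/81
-- leaves room. As `R` is bounded through both `P` and `Q`, the estimate does not force N(Q) alone
-- to decrease, whence a weighted sum. The floor is a relation on Cauchy sequences, so one has to be
-- exhibited at each step: balanced digits are computed for the rational coordinates, and each later
-- complete quotient is taken to be a pair of constant sequences.

-- γ² + coeff γ · γ + 1 = 0
coeff : Generator → ℤ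
coeff ι = + 0
coeff ω = + 1

-- The norm form of ℤ[γ] and the descent inequality.

module Norm where
  open import Data.Integer.Base using (_+_; _*_; _-_; -_; _≤_; _<_)
  open ℤ-Solver

  -- The product of a + b γ with its conjugate, as γ and its conjugate have sum -t and product 1.
  norm : ℤ → ℤ × ℤ → ℤ
  norm t (a , b) = a * a - t * (a * b) + b * b

  -- `mul₀` and `mul₁` are the coordinates of a product in ℤ[γ], reduced by γ² = -t γ - 1.
  mul₀ : ℤ × ℤ → ℤ × ℤ → ℤ
  mul₀ (a , b) (c , d) = a * c - b * d

  mul₁ : ℤ → ℤ × ℤ → ℤ × ℤ → ℤ
  mul₁ t (a , b) (c , d) = a * d + b * c - t * (b * d)

  private
    nm : ∀ {n} (t a b : Polynomial n) → Polynomial n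
    nm t a b = a :* a :- t :* (a :* b) :+ b :* b

  norm-* : ∀ t x y → norm t (mul₀ x y , mul₁ t x y) ≡ norm t x * norm t y
  norm-* t (a , b) (c , d) = solve 5 (λ t a b c d →
    nm t (a :* c :- b :* d) (a :* d :+ b :* c :- t :* (b :* d)) := nm t a b :* nm t c d)
    refl t a b c d

  norm-scale : ∀ t e a b → norm t (e * a , e * b) ≡ e * e * norm t (a , b)
  norm-scale = solve 4 (λ t e a b → nm t (e :* a) (e :* b) := e :* e :* nm t a b) refl

  -- The cross terms of 6 N(u - v) and N(6 u + v) cancel. Dropping the nonnegative second norm
  -- leaves 6 N(u - v) ≤ 42 N(u) + 7 N(v).
  norm-diff : ∀ t a b c d →
    + 42 * norm t (a , b) + + 7 * norm t (c , d) ≡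
    + 6 * norm t (a - c , b - d) + norm t (+ 6 * a + c , + 6 * b + d)
  norm-diff = solve 5 (λ t a b c d →
    con (+ 42) :* nm t a b :+ con (+ 7) :* nm t c d :=
    con (+ 6) :* nm t (a :- c) (b :- d) :+ nm t (con (+ 6) :* a :+ c) (con (+ 6) :* b :+ d))
    refl

  square : ∀ i → + (ℤ.∣ i ∣ ℕ.* ℤ.∣ i ∣) ≡ i * i
  square (+ n)      = ℤ.pos-* n n
  square ℤ.-[1+ n ] = refl

  square-nonneg : ∀ i → + 0 ≤ i * i
  square-nonneg i = subst (+ 0 ≤_) (square i) (ℤ.+≤+ ℕ.z≤n)

  square-pos : ∀ i → ¬ i ≡ + 0 → + 0 < i * i
  square-pos (+ 0) i≢0         = contradiction refl i≢0
  square-pos (+ suc n) _       = ℤ.+<+ (ℕ.s≤s ℕ.z≤n)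
  square-pos ℤ.-[1+ n ] _      = ℤ.+<+ (ℕ.s≤s ℕ.z≤n)

  -- Completing the square makes the form visibly positive definite.
  norm-ω : ∀ a b → + 4 * norm (+ 1) (a , b) ≡ (+ 2 * a - b) * (+ 2 * a - b) + + 3 * (b * b)
  norm-ω = solve 2 (λ a b → con (+ 4) :* nm (con (+ 1)) a b :=
    (con (+ 2) :* a :- b) :* (con (+ 2) :* a :- b) :+ con (+ 3) :* (b :* b)) refl

  norm-ι : ∀ a b → norm (+ 0) (a , b) ≡ a * a + b * b
  norm-ι = solve 2 (λ a b → nm (con (+ 0)) a b := a :* a :+ b :* b) refl

  norm-nonneg : ∀ γ x → + 0 ≤ norm (coeff γ) x
  norm-nonneg ι (a , b) = subst (+ 0 ≤_) (sym (norm-ι a b))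
    (ℤ.+-mono-≤ (square-nonneg a) (square-nonneg b))
  norm-nonneg ω (a , b) = ℤ.*-cancelˡ-≤-pos _ _ (+ 4) (subst (+ 0 ≤_) (sym (norm-ω a b))
    (ℤ.+-mono-≤ (square-nonneg (+ 2 * a - b)) (ℤ.*-monoˡ-≤-nonNeg (+ 3) (square-nonneg b))))

  norm-pos : ∀ γ a b → ¬ (a ≡ + 0 × b ≡ + 0) → + 0 < norm (coeff γ) (a , b)
  norm-pos ι a b ≢0 with b ℤ.≟ + 0
  ... | yes refl = subst (+ 0 <_) (sym (norm-ι a b))
    (ℤ.+-mono-<-≤ (square-pos a λ a≡0 → ≢0 (a≡0 , refl)) (square-nonneg b))
  ... | no b≢0 = subst (+ 0 <_) (sym (norm-ι a b))
    (ℤ.+-mono-≤-< (square-nonneg a) (square-pos b b≢0))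
  norm-pos ω a b ≢0 with b ℤ.≟ + 0
  ... | yes refl = subst (+ 0 <_) (sym (solve 1 (λ a →
      nm (con (+ 1)) a (con (+ 0)) := a :* a) refl a))
    (square-pos a λ a≡0 → ≢0 (a≡0 , refl))
  ... | no b≢0 = ℤ.*-cancelˡ-<-nonNeg (+ 4) (subst (+ 0 <_) (sym (norm-ω a b))
    (ℤ.+-mono-≤-< (square-nonneg (+ 2 * a - b)) (ℤ.*-monoˡ-<-pos (+ 3) (square-pos b b≢0))))

  i≤+∣i∣ : ∀ i → i ≤ + ℤ.∣ i ∣
  i≤+∣i∣ (+ n)      = ℤ.≤-refl
  i≤+∣i∣ ℤ.-[1+ n ] = ℤ.-≤+

  i*j≤e*e : ∀ i j e → ℤ.∣ i ∣ ℕ.≤ e → ℤ.∣ j ∣ ℕ.≤ e → i * j ≤ + e * + e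
  i*j≤e*e i j e i≤e j≤e = ℤ.≤-trans (i≤+∣i∣ (i * j))
    (subst₂ _≤_ (cong +_ (sym (ℤ.abs-* i j))) (ℤ.pos-* e e) (ℤ.+≤+ (ℕ.*-mono-≤ i≤e j≤e)))

  -- The left side is (2a)² + (2b)² - t (2a)(2b) with t equal to 0 or 1, and each of the three terms
  -- is at most e². Doubling the coordinates expresses |a| ≤ e / 2 without division.
  norm-bound : ∀ γ a b e → ℤ.∣ + 2 * a ∣ ℕ.≤ e → ℤ.∣ + 2 * b ∣ ℕ.≤ e →
    + 4 * norm (coeff γ) (a , b) ≤ + 3 * (+ e * + e)
  norm-bound γ a b e a≤e b≤e = ℤ.≤-trans (ℤ.≤-reflexive (expand (coeff γ) a b))
    (ℤ.≤-trans (ℤ.+-mono-≤ (ℤ.+-mono-≤ (i*j≤e*e (+ 2 * a) (+ 2 * a) e a≤e a≤e)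
        (i*j≤e*e (+ 2 * b) (+ 2 * b) e b≤e b≤e)) (cross γ))
      (ℤ.≤-reflexive (solve 1 (λ x → x :+ x :+ x := con (+ 3) :* x) refl (+ e * + e))))
    where
    expand : ∀ t a b → + 4 * norm t (a , b) ≡
      (+ 2 * a) * (+ 2 * a) + (+ 2 * b) * (+ 2 * b) + (- t) * ((+ 2 * a) * (+ 2 * b))
    expand = solve 3 (λ t a b → con (+ 4) :* nm t a b :=
      (con (+ 2) :* a) :* (con (+ 2) :* a) :+ (con (+ 2) :* b) :* (con (+ 2) :* b)
      :+ (:- t) :* ((con (+ 2) :* a) :* (con (+ 2) :* b))) refl
    cross : ∀ γ → (- coeff γ) * ((+ 2 * a) * (+ 2 * b)) ≤ + e * + e
    cross ι = subst (_≤ + e * + e) (sym (ℤ.*-zeroˡ ((+ 2 * a) * (+ 2 * b)))) (square-nonneg (+ e))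
    cross ω = subst (_≤ + e * + e)
      (solve 2 (λ x y → (:- x) :* y := (:- con (+ 1)) :* (x :* y)) refl (+ 2 * a) (+ 2 * b))
      (i*j≤e*e (- (+ 2 * a)) (+ 2 * b) e
        (subst (ℕ._≤ e) (sym (ℤ.∣-i∣≡∣i∣ (+ 2 * a))) a≤e) b≤e)

  -- 648 = 8 · 81 clears the denominators of r ≤ (7/81) p + (7/8) q.
  contraction : ∀ f e g p q r .{{_ : ℤ.Positive e}} → + 0 ≤ p → + 0 ≤ q →
    + 6 * (e * r) ≤ + 42 * (f * p) + + 7 * (g * q) → + 4 * g ≤ + 3 * e → + 81 * f ≤ e →
    + 648 * r ≤ + 56 * p + + 567 * q
  contraction f e g p q r 0≤p 0≤q r≤ g≤ f≤ = ℤ.*-cancelˡ-≤-pos _ _ e (begin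
    e * (+ 648 * r)                                       ≡⟨ lhs e r ⟩
    + 108 * (+ 6 * (e * r))                               ≤⟨ ℤ.*-monoˡ-≤-nonNeg (+ 108) r≤ ⟩
    + 108 * (+ 42 * (f * p) + + 7 * (g * q))              ≡⟨ mid f g p q ⟩
    + 56 * (+ 81 * f * p) + + 189 * (+ 4 * g * q)
      ≤⟨ ℤ.+-mono-≤
           (ℤ.*-monoˡ-≤-nonNeg (+ 56) (ℤ.*-monoʳ-≤-nonNeg p ⦃ ℤ.nonNegative 0≤p ⦄ f≤))
           (ℤ.*-monoˡ-≤-nonNeg (+ 189) (ℤ.*-monoʳ-≤-nonNeg q ⦃ ℤ.nonNegative 0≤q ⦄ g≤)) ⟩
    + 56 * (e * p) + + 189 * (+ 3 * e * q)                ≡⟨ rhs e p q ⟩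
    e * (+ 56 * p + + 567 * q)                            ∎)
    where
    open ℤ.≤-Reasoning
    lhs : ∀ e r → e * (+ 648 * r) ≡ + 108 * (+ 6 * (e * r))
    lhs = solve 2 (λ e r → e :* (con (+ 648) :* r) := con (+ 108) :* (con (+ 6) :* (e :* r))) refl
    mid : ∀ f g p q → + 108 * (+ 42 * (f * p) + + 7 * (g * q)) ≡
      + 56 * (+ 81 * f * p) + + 189 * (+ 4 * g * q)
    mid = solve 4 (λ f g p q →
      con (+ 108) :* (con (+ 42) :* (f :* p) :+ con (+ 7) :* (g :* q)) :=
      con (+ 56) :* (con (+ 81) :* f :* p) :+ con (+ 189) :* (con (+ 4) :* g :* q)) refl
    rhs : ∀ e p q → + 56 * (e * p) + + 189 * (+ 3 * e * q) ≡ e * (+ 56 * p + + 567 * q)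
    rhs = solve 3 (λ e p q → con (+ 56) :* (e :* p) :+ con (+ 189) :* (con (+ 3) :* e :* q) :=
      e :* (con (+ 56) :* p :+ con (+ 567) :* q)) refl

  -- Here p, q, r stand for N(P), N(Q), N(R). With a weight w in place of 10 the hypothesis gives w
  -- r + q ≤ (7w/81) p + (7w/8 + 1) q, so any w with 8 < w ≤ 81/7 would serve. Strictness comes from
  -- the q term.
  strict : ∀ p q r → + 0 ≤ p → + 0 < q → + 648 * r ≤ + 56 * p + + 567 * q →
    + 10 * r + q < + 10 * q + p
  strict p q r 0≤p 0<q h = ℤ.*-cancelˡ-<-nonNeg (+ 648) (begin-strict
    + 648 * (+ 10 * r + q)                    ≡⟨ lhs q r ⟩
    + 10 * (+ 648 * r) + + 648 * q            ≤⟨ ℤ.+-monoˡ-≤ (+ 648 * q) (ℤ.*-monoˡ-≤-nonNeg (+ 10) h) ⟩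
    + 10 * (+ 56 * p + + 567 * q) + + 648 * q ≡⟨ mid p q ⟩
    + 560 * p + + 6318 * q + + 0              <⟨ ℤ.+-monoʳ-< (+ 560 * p + + 6318 * q)
      (ℤ.+-mono-≤-< (ℤ.*-monoˡ-≤-nonNeg (+ 88) 0≤p) (ℤ.*-monoˡ-<-pos (+ 162) 0<q)) ⟩
    + 560 * p + + 6318 * q + (+ 88 * p + + 162 * q) ≡⟨ rhs p q ⟩
    + 648 * (+ 10 * q + p)                    ∎)
    where
    open ℤ.≤-Reasoning
    lhs : ∀ q r → + 648 * (+ 10 * r + q) ≡ + 10 * (+ 648 * r) + + 648 * q
    lhs = solve 2 (λ q r → con (+ 648) :* (con (+ 10) :* r :+ q) :=
      con (+ 10) :* (con (+ 648) :* r) :+ con (+ 648) :* q) refl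
    mid : ∀ p q → + 10 * (+ 56 * p + + 567 * q) + + 648 * q ≡ + 560 * p + + 6318 * q + + 0
    mid = solve 2 (λ p q → con (+ 10) :* (con (+ 56) :* p :+ con (+ 567) :* q) :+ con (+ 648) :* q :=
      con (+ 560) :* p :+ con (+ 6318) :* q :+ con (+ 0)) refl
    rhs : ∀ p q → + 560 * p + + 6318 * q + (+ 88 * p + + 162 * q) ≡ + 648 * (+ 10 * q + p)
    rhs = solve 2 (λ p q → con (+ 560) :* p :+ con (+ 6318) :* q :+ (con (+ 88) :* p :+ con (+ 162) :* q)
      := con (+ 648) :* (con (+ 10) :* q :+ p)) refl

  -- To be used with f = p^N, e = p^(2+N) and g = p^(1+N) c: then f / e = 1 / p² and g / e = c / p,
  -- and the two equations are p² R = P - p c Q with the denominators of c cleared.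
  descent : ∀ γ f e g₀ g₁ P₀ P₁ Q R₀ R₁ → 0 ℕ.< e → 9 ℕ.* f ℕ.≤ e →
    ℤ.∣ + 2 * g₀ ∣ ℕ.≤ e → ℤ.∣ + 2 * g₁ ∣ ℕ.≤ e → + 0 < norm (coeff γ) Q →
    + e * R₀ ≡ + f * P₀ - mul₀ (g₀ , g₁) Q →
    + e * R₁ ≡ + f * P₁ - mul₁ (coeff γ) (g₀ , g₁) Q →
    + 10 * norm (coeff γ) (R₀ , R₁) + norm (coeff γ) Q <
    + 10 * norm (coeff γ) Q + norm (coeff γ) (P₀ , P₁)
  descent γ f e@(suc _) g₀ g₁ P₀ P₁ Q R₀ R₁ _ f≤e g₀≤e g₁≤e 0<Q eq₀ eq₁ =
    strict (N (P₀ , P₁)) (N Q) (N (R₀ , R₁)) (norm-nonneg γ (P₀ , P₁)) 0<Q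
      (contraction (+ f * + f) (+ e * + e) (N (g₀ , g₁)) (N (P₀ , P₁)) (N Q) (N (R₀ , R₁))
        (norm-nonneg γ (P₀ , P₁)) (ℤ.<⇒≤ 0<Q) estimate (norm-bound γ g₀ g₁ e g₀≤e g₁≤e) squares)
    where
    t = coeff γ
    N = norm t
    c₀ = mul₀ (g₀ , g₁) Q
    c₁ = mul₁ t (g₀ , g₁) Q
    squares : + 81 * (+ f * + f) ≤ + e * + e
    squares = subst (_≤ + e * + e) (trans (cong₂ _*_ (ℤ.pos-* 9 f) (ℤ.pos-* 9 f))
      (solve 1 (λ f → (con (+ 9) :* f) :* (con (+ 9) :* f) := con (+ 81) :* (f :* f)) refl (+ f)))
      (i*j≤e*e (+ (9 ℕ.* f)) (+ (9 ℕ.* f)) e f≤e f≤e)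
    estimate : + 6 * (+ e * + e * N (R₀ , R₁)) ≤
      + 42 * (+ f * + f * N (P₀ , P₁)) + + 7 * (N (g₀ , g₁) * N Q)
    estimate = begin
      + 6 * (+ e * + e * N (R₀ , R₁)) ≡⟨ cong (+ 6 *_) (norm-scale t (+ e) R₀ R₁) ⟨
      + 6 * N (+ e * R₀ , + e * R₁)   ≡⟨ cong₂ (λ u v → + 6 * N (u , v)) eq₀ eq₁ ⟩
      + 6 * N (+ f * P₀ - c₀ , + f * P₁ - c₁) ≡⟨ ℤ.+-identityʳ _ ⟨
      + 6 * N (+ f * P₀ - c₀ , + f * P₁ - c₁) + + 0
        ≤⟨ ℤ.+-monoʳ-≤ (+ 6 * N (+ f * P₀ - c₀ , + f * P₁ - c₁))
             (norm-nonneg γ (+ 6 * (+ f * P₀) + c₀ , + 6 * (+ f * P₁) + c₁)) ⟩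
      + 6 * N (+ f * P₀ - c₀ , + f * P₁ - c₁) + N (+ 6 * (+ f * P₀) + c₀ , + 6 * (+ f * P₁) + c₁)
        ≡⟨ norm-diff t (+ f * P₀) (+ f * P₁) c₀ c₁ ⟨
      + 42 * N (+ f * P₀ , + f * P₁) + + 7 * N (c₀ , c₁)
        ≡⟨ cong₂ (λ u v → + 42 * u + + 7 * v) (norm-scale t (+ f) P₀ P₁) (norm-* t (g₀ , g₁) Q) ⟩
      + 42 * (+ f * + f * N (P₀ , P₁)) + + 7 * (N (g₀ , g₁) * N Q) ∎
      where open ℤ.≤-Reasoning

-- The embedding of ℤ in ℚ.

fromℤ : ℤ → ℚ
fromℤ i = i / 1

toℚᵘ-fromℤ : ∀ i → toℚᵘ (fromℤ i) ℚᵘ.≃ mkℚᵘ i 0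
toℚᵘ-fromℤ i = ℚ.toℚᵘ-fromℚᵘ (mkℚᵘ i 0)

fromℤ-+ : ∀ i j → fromℤ (i ℤ.+ j) ≡ fromℤ i ℚ.+ fromℤ j
fromℤ-+ i j = ℚ.toℚᵘ-injective (ℚᵘ.≃-trans (toℚᵘ-fromℤ (i ℤ.+ j))
  (ℚᵘ.≃-trans (*≡* (solve 2 (λ i j → (i :+ j) :* con (+ 1) :=
      (i :* con (+ 1) :+ j :* con (+ 1)) :* con (+ 1)) refl i j))
    (ℚᵘ.≃-sym (ℚᵘ.≃-trans (ℚ.toℚᵘ-homo-+ (fromℤ i) (fromℤ j))
      (ℚᵘ.+-cong (toℚᵘ-fromℤ i) (toℚᵘ-fromℤ j))))))
  where open ℤ-Solver

fromℤ-* : ∀ i j → fromℤ (i ℤ.* j) ≡ fromℤ i ℚ.* fromℤ j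
fromℤ-* i j = ℚ.toℚᵘ-injective (ℚᵘ.≃-trans (toℚᵘ-fromℤ (i ℤ.* j))
  (ℚᵘ.≃-sym (ℚᵘ.≃-trans (ℚ.toℚᵘ-homo-* (fromℤ i) (fromℤ j))
    (ℚᵘ.*-cong (toℚᵘ-fromℤ i) (toℚᵘ-fromℤ j)))))

fromℤ-neg : ∀ i → fromℤ (ℤ.- i) ≡ ℚ.- fromℤ i
fromℤ-neg i = ℚ.toℚᵘ-injective (ℚᵘ.≃-trans (toℚᵘ-fromℤ (ℤ.- i))
  (ℚᵘ.≃-sym (ℚᵘ.≃-trans (ℚ.toℚᵘ-homo‿- (fromℤ i)) (ℚᵘ.-‿cong (toℚᵘ-fromℤ i)))))

fromℤ-minus : ∀ i j → fromℤ (i ℤ.- j) ≡ fromℤ i ℚ.- fromℤ j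
fromℤ-minus i j = trans (fromℤ-+ i (ℤ.- j)) (cong (fromℤ i ℚ.+_) (fromℤ-neg j))

fromℤ-injective : ∀ {i j} → fromℤ i ≡ fromℤ j → i ≡ j
fromℤ-injective {i} {j} eq with ℚ./-injective-≃ (mkℚᵘ i 0) (mkℚᵘ j 0) eq
... | *≡* e = trans (sym (ℤ.*-identityʳ i)) (trans e (ℤ.*-identityʳ j))

/-*-cancel : ∀ i d .{{_ : NonZero d}} → (i / d) ℚ.* fromℤ (+ d) ≡ fromℤ i
/-*-cancel i d@(suc d-1) = ℚ.toℚᵘ-injective (ℚᵘ.≃-trans (ℚ.toℚᵘ-homo-* (i / d) (fromℤ (+ d)))
  (ℚᵘ.≃-trans (ℚᵘ.*-cong (ℚ.toℚᵘ-fromℚᵘ (mkℚᵘ i d-1)) (toℚᵘ-fromℤ (+ d)))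
    (ℚᵘ.≃-trans (*≡* (trans (ℤ.*-identityʳ (i ℤ.* + d))
        (cong (λ n → i ℤ.* + n) (sym (ℕ.*-identityʳ d)))))
      (ℚᵘ.≃-sym (toℚᵘ-fromℤ i)))))

*-↧ : ∀ x → x ℚ.* fromℤ (+ ↧ₙ x) ≡ fromℤ (↥ x)
*-↧ x@record{} = subst (λ y → y ℚ.* fromℤ (+ ↧ₙ x) ≡ fromℤ (↥ x)) (ℚ.↥p/↧p≡p x)
  (/-*-cancel (↥ x) (↧ₙ x))

fromℤ-cancelʳ : ∀ {x y} d .{{_ : NonZero d}} → x ℚ.* fromℤ (+ d) ≡ y ℚ.* fromℤ (+ d) → x ≡ y
fromℤ-cancelʳ {x} {y} d eq = trans (undo x) (trans (cong (ℚ._* ((+ 1) / d)) eq) (sym (undo y)))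
  where
  undo : ∀ x → x ≡ x ℚ.* fromℤ (+ d) ℚ.* ((+ 1) / d)
  undo x = sym (trans (ℚ.*-assoc x (fromℤ (+ d)) ((+ 1) / d))
    (trans (cong (x ℚ.*_) (trans (ℚ.*-comm (fromℤ (+ d)) ((+ 1) / d)) (/-*-cancel (+ 1) d)))
      (ℚ.*-identityʳ x)))

-- Balanced digits of a p-integral rational.

module Digits (p : ℕ) (p-prime : Prime p) (h : ℕ) (p≡1+2h : p ≡ suc (h ℕ.+ h)) where

  open Padic p p-prime

  inverse-mod-p : ∀ d → p ∤ d → ∃₂ λ m l → m ℤ.* + d ℤ.+ l ℤ.* + p ≡ + 1
  inverse-mod-p d p∤d with coprime-Bézout {p} {d} (λ { (i∣p , i∣d) →
    [ id , (λ { refl → contradiction i∣d p∤d }) ]′ (prime⇒irreducible p-prime i∣p) })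
  ... | Bézout.+- x y eq = ℤ.- + y , + x , (begin
    (ℤ.- + y) ℤ.* + d ℤ.+ + x ℤ.* + p          ≡⟨ cong (λ n → (ℤ.- + y) ℤ.* + d ℤ.+ n) (ℤ.pos-* x p) ⟨
    (ℤ.- + y) ℤ.* + d ℤ.+ + (x ℕ.* p)          ≡⟨ cong (λ n → (ℤ.- + y) ℤ.* + d ℤ.+ + n) eq ⟨
    (ℤ.- + y) ℤ.* + d ℤ.+ + (1 ℕ.+ y ℕ.* d)
      ≡⟨ cong (λ n → (ℤ.- + y) ℤ.* + d ℤ.+ (+ 1 ℤ.+ n)) (ℤ.pos-* y d) ⟩
    (ℤ.- + y) ℤ.* + d ℤ.+ (+ 1 ℤ.+ + y ℤ.* + d)
      ≡⟨ solve 2 (λ y d → (:- y) :* d :+ (con (+ 1) :+ y :* d) := con (+ 1)) refl (+ y) (+ d) ⟩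
    + 1 ∎)
    where
    open ≡-Reasoning
    open ℤ-Solver
  ... | Bézout.-+ x y eq = + y , ℤ.- + x , (begin
    + y ℤ.* + d ℤ.+ (ℤ.- + x) ℤ.* + p          ≡⟨ cong (ℤ._+ (ℤ.- + x) ℤ.* + p) (ℤ.pos-* y d) ⟨
    + (y ℕ.* d) ℤ.+ (ℤ.- + x) ℤ.* + p          ≡⟨ cong (λ n → + n ℤ.+ (ℤ.- + x) ℤ.* + p) eq ⟨
    + (1 ℕ.+ x ℕ.* p) ℤ.+ (ℤ.- + x) ℤ.* + p    ≡⟨ cong (λ n → + 1 ℤ.+ n ℤ.+ (ℤ.- + x) ℤ.* + p) (ℤ.pos-* x p) ⟩
    + 1 ℤ.+ + x ℤ.* + p ℤ.+ (ℤ.- + x) ℤ.* + p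
      ≡⟨ solve 2 (λ x p → con (+ 1) :+ x :* p :+ (:- x) :* p := con (+ 1)) refl (+ x) (+ p) ⟩
    + 1 ∎)
    where
    open ≡-Reasoning
    open ℤ-Solver

  -- Shifting by h before and after ordinary division turns the residues 0, ..., 2h into -h, ..., h.
  balanced-residue : ∀ i → ∃₂ λ a k → ℤ.∣ a ∣ ℕ.≤ h × i ≡ a ℤ.+ k ℤ.* + p
  balanced-residue i = + r ℤ.- + h , k , small , (begin
    i                              ≡⟨ solve 2 (λ i h → i := i :+ h :- h) refl i (+ h) ⟩
    i ℤ.+ + h ℤ.- + h              ≡⟨ cong (ℤ._- + h) (ℤ.a≡a%ℕn+[a/ℕn]*n (i ℤ.+ + h) p) ⟩
    + r ℤ.+ k ℤ.* + p ℤ.- + h      ≡⟨ solve 3 (λ r h m → r :+ m :- h := r :- h :+ m) refl (+ r) (+ h) (k ℤ.* + p) ⟩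
    + r ℤ.- + h ℤ.+ k ℤ.* + p      ∎)
    where
    open ≡-Reasoning
    open ℤ-Solver
    r = (i ℤ.+ + h) ℤ.%ℕ p
    k = (i ℤ.+ + h) ℤ./ℕ p
    r≤2h : r ℕ.≤ h ℕ.+ h
    r≤2h = ℕ.≤-pred (subst (r ℕ.<_) p≡1+2h (ℤ.n%ℕd<d (i ℤ.+ + h) p))
    distance : ∀ r → r ℕ.≤ h ℕ.+ h → ℤ.∣ r ⊖ h ∣ ℕ.≤ h
    distance r r≤2h with ℕ.≤-total r h
    ... | inj₁ r≤h = ℕ.≤-trans (ℕ.≤-reflexive (ℤ.∣⊖∣-≤ r≤h)) (ℕ.m∸n≤m h r)
    ... | inj₂ h≤r = ℕ.≤-trans
      (ℕ.≤-reflexive (trans (ℤ.∣m⊖n∣≡∣n⊖m∣ r h) (ℤ.∣⊖∣-≤ h≤r))) (ℕ.m≤n+o⇒m∸n≤o r h r≤2h)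
    small : ℤ.∣ + r ℤ.- + h ∣ ℕ.≤ h
    small = subst (λ i → ℤ.∣ i ∣ ℕ.≤ h) (sym (ℤ.m-n≡m⊖n r h)) (distance r r≤2h)

  record Digit (z : ℚ) : Set where
    field
      digit    : ℤ
      balanced : ℤ.∣ digit ∣ ℕ.≤ h
      quotient : ℚ
      integral : Integral quotient
      split    : z ≡ fromℤ digit ℚ.+ fromℤ (+ p) ℚ.* quotient

  -- With z = u / d and m d + l p = 1, the digit is the balanced residue of u m.
  firstDigit : ∀ {z} → Integral z → Digit z
  firstDigit {z} (p∤↧ p∤d) with inverse-mod-p (↧ₙ z) p∤d
  ... | m , l , bezout with balanced-residue (↥ z ℤ.* m)
  ... | a , k , a≤h , um≡ = record
    { digit = a ; balanced = a≤h ; quotient = v / d ; integral = integral-/ v d p∤d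
    ; split = fromℤ-cancelʳ d (begin
        z ℚ.* fromℤ (+ d)    ≡⟨ *-↧ z ⟩
        fromℤ u              ≡⟨ cong fromℤ u≡ ⟩
        fromℤ (a ℤ.* + d ℤ.+ + p ℤ.* v) ≡⟨ fromℤ-+ (a ℤ.* + d) (+ p ℤ.* v) ⟩
        fromℤ (a ℤ.* + d) ℚ.+ fromℤ (+ p ℤ.* v) ≡⟨ cong₂ ℚ._+_ (fromℤ-* a (+ d)) (fromℤ-* (+ p) v) ⟩
        fromℤ a ℚ.* fromℤ (+ d) ℚ.+ fromℤ (+ p) ℚ.* fromℤ v
          ≡⟨ cong (λ w → fromℤ a ℚ.* fromℤ (+ d) ℚ.+ fromℤ (+ p) ℚ.* w) (/-*-cancel v d) ⟨
        fromℤ a ℚ.* fromℤ (+ d) ℚ.+ fromℤ (+ p) ℚ.* (v / d ℚ.* fromℤ (+ d))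
          ≡⟨ ℚ-Solver.solve 4 (λ a d p w → a :* d :+ p :* (w :* d) := (a :+ p :* w) :* d) refl
               (fromℤ a) (fromℤ (+ d)) (fromℤ (+ p)) (v / d) ⟩
        (fromℤ a ℚ.+ fromℤ (+ p) ℚ.* (v / d)) ℚ.* fromℤ (+ d) ∎) }
    where
    open ≡-Reasoning
    open ℚ-Solver using (_:+_; _:*_; _:=_)
    u = ↥ z
    d = ↧ₙ z
    -- Since u = (u m) d + u l p and u m = a + k p, the difference u - a d is p v. Thus the quotient
    -- (z - a) / p is v / d, with the old denominator d, and remains p-integral.
    v = u ℤ.* l ℤ.+ k ℤ.* + d
    u≡ : u ≡ a ℤ.* + d ℤ.+ + p ℤ.* v
    u≡ = begin
      u                                                ≡⟨ ℤ.*-identityʳ u ⟨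
      u ℤ.* + 1                                        ≡⟨ cong (u ℤ.*_) bezout ⟨
      u ℤ.* (m ℤ.* + d ℤ.+ l ℤ.* + p)                  ≡⟨ I.solve 5 (λ u m d l p →
        u I.:* (m I.:* d I.:+ l I.:* p) I.:= (u I.:* m) I.:* d I.:+ u I.:* l I.:* p) refl u m (+ d) l (+ p) ⟩
      (u ℤ.* m) ℤ.* + d ℤ.+ u ℤ.* l ℤ.* + p            ≡⟨ cong (λ i → i ℤ.* + d ℤ.+ u ℤ.* l ℤ.* + p) um≡ ⟩
      (a ℤ.+ k ℤ.* + p) ℤ.* + d ℤ.+ u ℤ.* l ℤ.* + p    ≡⟨ I.solve 6 (λ u a k d l p →
        (a I.:+ k I.:* p) I.:* d I.:+ u I.:* l I.:* p I.:= a I.:* d I.:+ p I.:* (u I.:* l I.:+ k I.:* d))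
        refl u a k (+ d) l (+ p) ⟩
      a ℤ.* + d ℤ.+ + p ℤ.* v                          ∎
      where module I = ℤ-Solver

  fromℤ-p^ : ∀ n → fromℤ (+ (p ℕ.^ n)) ≡ p^ (+ n)
  fromℤ-p^ zero    = refl
  fromℤ-p^ (suc n) = trans (cong fromℤ (ℤ.pos-* p (p ℕ.^ n)))
    (trans (fromℤ-* (+ p) (+ (p ℕ.^ n))) (cong (fromℤ (+ p) ℚ.*_) (fromℤ-p^ n)))

  p^-⊖ : ∀ n N → p^ (n ⊖ N) ℚ.* p^ (+ N) ≡ p^ (+ n)
  p^-⊖ n       zero    = ℚ.*-identityʳ (p^ (+ n))
  p^-⊖ zero    (suc N) = trans (ℚ.*-comm (p⁻ (suc N)) (p^ (+ suc N))) (p^*p⁻ (suc N))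
  p^-⊖ (suc n) (suc N) = trans (cong (λ j → p^ j ℚ.* p^ (+ suc N)) (ℤ.[1+m]⊖[1+n]≡m⊖n n N))
    (trans (ℚ-Solver.solve 3 (λ x y z → x :* (y :* z) := y :* (x :* z)) refl
      (p^ (n ⊖ N)) (fromℤ (+ p)) (p^ (+ N))) (cong (fromℤ (+ p) ℚ.*_) (p^-⊖ n N)))
    where open ℚ-Solver using (_:*_; _:=_)

  module Expand (z : ℚ) (z-integral : Integral z) where
    open Digit

    -- The integrality proof travels with the tail because a next digit exists only for a p-integral
    -- number.
    tail : ℕ → ∃ Integral
    tail zero    = z , z-integral
    tail (suc n) = let d = firstDigit (proj₂ (tail n)) in quotient d , integral d

    digits : ℕ → ℤ
    digits n = digit (firstDigit (proj₂ (tail n)))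

    digits-balanced : ∀ n → ℤ.∣ digits n ∣ ℕ.≤ h
    digits-balanced n = balanced (firstDigit (proj₂ (tail n)))

    -- Kept in ℤ since its ordinary absolute value is needed besides its p-adic meaning.
    prefix : ℕ → ℤ
    prefix zero    = + 0
    prefix (suc n) = prefix n ℤ.+ digits n ℤ.* + (p ℕ.^ n)

    fromℤ-prefix : ∀ n → fromℤ (prefix (suc n)) ≡ fromℤ (prefix n) ℚ.+ fromℤ (digits n) ℚ.* p^ (+ n)
    fromℤ-prefix n = trans (fromℤ-+ (prefix n) (digits n ℤ.* + (p ℕ.^ n)))
      (cong (fromℤ (prefix n) ℚ.+_) (trans (fromℤ-* (digits n) (+ (p ℕ.^ n)))
        (cong (fromℤ (digits n) ℚ.*_) (fromℤ-p^ n))))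

    prefix-tail : ∀ n → z ≡ fromℤ (prefix n) ℚ.+ p^ (+ n) ℚ.* proj₁ (tail n)
    prefix-tail zero    = sym (trans (ℚ.+-identityˡ _) (ℚ.*-identityˡ z))
    prefix-tail (suc n) = begin
      z ≡⟨ prefix-tail n ⟩
      fromℤ (prefix n) ℚ.+ p^ (+ n) ℚ.* proj₁ (tail n)
        ≡⟨ cong (λ w → fromℤ (prefix n) ℚ.+ p^ (+ n) ℚ.* w) (split (firstDigit (proj₂ (tail n)))) ⟩
      fromℤ (prefix n) ℚ.+ p^ (+ n) ℚ.* (fromℤ (digits n) ℚ.+ fromℤ (+ p) ℚ.* proj₁ (tail (suc n)))
        ≡⟨ solve 5 (λ s q a p w → s :+ q :* (a :+ p :* w) := s :+ a :* q :+ p :* q :* w) refl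
             (fromℤ (prefix n)) (p^ (+ n)) (fromℤ (digits n)) (fromℤ (+ p)) (proj₁ (tail (suc n))) ⟩
      fromℤ (prefix n) ℚ.+ fromℤ (digits n) ℚ.* p^ (+ n) ℚ.+ p^ (+ suc n) ℚ.* proj₁ (tail (suc n))
        ≡⟨ cong (ℚ._+ p^ (+ suc n) ℚ.* proj₁ (tail (suc n))) (fromℤ-prefix n) ⟨
      fromℤ (prefix (suc n)) ℚ.+ p^ (+ suc n) ℚ.* proj₁ (tail (suc n)) ∎
      where
      open ≡-Reasoning
      open ℚ-Solver

    -- Digits of size at most h = (p - 1) / 2 sum to at most h (1 + p + ... + p^(n-1)) = (p^n - 1) /
    -- 2. Inductively, p^n + 2 h p^n = p^(n+1).
    prefix-bound : ∀ n → 2 ℕ.* ℤ.∣ prefix n ∣ ℕ.< p ℕ.^ n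
    prefix-bound zero    = ℕ.s≤s ℕ.z≤n
    prefix-bound (suc n) = begin-strict
      2 ℕ.* ℤ.∣ prefix (suc n) ∣
        ≤⟨ ℕ.*-monoʳ-≤ 2 (ℤ.∣i+j∣≤∣i∣+∣j∣ (prefix n) (digits n ℤ.* + (p ℕ.^ n))) ⟩
      2 ℕ.* (ℤ.∣ prefix n ∣ ℕ.+ ℤ.∣ digits n ℤ.* + (p ℕ.^ n) ∣)
        ≡⟨ cong (λ m → 2 ℕ.* (ℤ.∣ prefix n ∣ ℕ.+ m)) (ℤ.abs-* (digits n) (+ (p ℕ.^ n))) ⟩
      2 ℕ.* (ℤ.∣ prefix n ∣ ℕ.+ ℤ.∣ digits n ∣ ℕ.* p ℕ.^ n)
        ≡⟨ solve 3 (λ s a q → con 2 :* (s :+ a :* q) := con 2 :* s :+ (con 2 :* a) :* q) refl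
             ℤ.∣ prefix n ∣ ℤ.∣ digits n ∣ (p ℕ.^ n) ⟩
      2 ℕ.* ℤ.∣ prefix n ∣ ℕ.+ (2 ℕ.* ℤ.∣ digits n ∣) ℕ.* p ℕ.^ n
        <⟨ ℕ.+-mono-<-≤ (prefix-bound n)
             (ℕ.*-monoˡ-≤ (p ℕ.^ n) (ℕ.*-monoʳ-≤ 2 (digits-balanced n))) ⟩
      p ℕ.^ n ℕ.+ (2 ℕ.* h) ℕ.* p ℕ.^ n
        ≡⟨ solve 2 (λ h q → q :+ (con 2 :* h) :* q := (con 1 :+ (h :+ h)) :* q) refl h (p ℕ.^ n) ⟩
      suc (h ℕ.+ h) ℕ.* p ℕ.^ n  ≡⟨ cong (ℕ._* p ℕ.^ n) p≡1+2h ⟨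
      p ℕ.^ suc n                ∎
      where
      open ℕ.≤-Reasoning
      open ℕ-Solver

-- Integrality, convergence in ℚₚ, and the floor of a rational.

module Floors (p : ℕ) (p-prime : Prime p) (h : ℕ) (p≡1+2h : p ≡ suc (h ℕ.+ h)) where
  open Padic p p-prime
  open Digits p p-prime h p≡1+2h

  -- For x = u / d the hypothesis reads u p = i d. As p does not divide d, Euclid's lemma makes it
  -- divide i.
  integer-of-p* : ∀ {x} → Integral x → ∀ i → x ℚ.* fromℤ (+ p) ≡ fromℤ i → ∃ λ j → x ≡ fromℤ j
  integer-of-p* {x} (p∤↧ p∤d) i xp≡i = j , fromℤ-cancelʳ p (trans xp≡i
      (trans (cong fromℤ i≡jp) (fromℤ-* j (+ p))))
    where
    open ≡-Reasoning
    d = ↧ₙ x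
    up≡id : ↥ x ℤ.* + p ≡ i ℤ.* + d
    up≡id = fromℤ-injective (begin
      fromℤ (↥ x ℤ.* + p)             ≡⟨ fromℤ-* (↥ x) (+ p) ⟩
      fromℤ (↥ x) ℚ.* fromℤ (+ p)     ≡⟨ cong (ℚ._* fromℤ (+ p)) (*-↧ x) ⟨
      x ℚ.* fromℤ (+ d) ℚ.* fromℤ (+ p)
        ≡⟨ solve 3 (λ x d p → x :* d :* p := x :* p :* d) refl x (fromℤ (+ d)) (fromℤ (+ p)) ⟩
      x ℚ.* fromℤ (+ p) ℚ.* fromℤ (+ d) ≡⟨ cong (ℚ._* fromℤ (+ d)) xp≡i ⟩
      fromℤ i ℚ.* fromℤ (+ d)         ≡⟨ fromℤ-* i (+ d) ⟨
      fromℤ (i ℤ.* + d)               ∎)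
      where open ℚ-Solver using (solve; _:*_; _:=_)
    p∣id : p ∣ ℤ.∣ i ∣ ℕ.* d
    p∣id = divides ℤ.∣ ↥ x ∣ (trans (sym (ℤ.abs-* i (+ d)))
      (trans (cong ℤ.∣_∣ (sym up≡id)) (ℤ.abs-* (↥ x) (+ p))))
    p∣i : (+ p) Signed.∣ i
    p∣i = Signed.∣ᵤ⇒∣ ([ id , (λ p∣d → contradiction p∣d p∤d) ]′
      (euclidsLemma ℤ.∣ i ∣ d p-prime p∣id))
    j = Signed._∣_.quotient p∣i
    i≡jp = Signed._∣_.equality p∣i

  -- One factor p is removed at a time, x p^N being p-integral again. This local-to-global step is
  -- what places the remainder in ℤ[γ].
  integer-of-p^* : ∀ N {x} → Integral x → ∀ i → x ℚ.* p^ (+ N) ≡ fromℤ i → ∃ λ j → x ≡ fromℤ j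
  integer-of-p^* zero    {x} _  i eq = i , trans (sym (ℚ.*-identityʳ x)) eq
  integer-of-p^* (suc N) {x} ix i eq =
    let j , eq′ = integer-of-p* (integral-* ix (integral-p^ N)) i
                   (trans (swap x (p^ (+ N)) (fromℤ (+ p))) eq)
    in integer-of-p^* N ix j eq′
    where
    open ℚ-Solver
    swap : ∀ x q p → x ℚ.* q ℚ.* p ≡ x ℚ.* (p ℚ.* q)
    swap = solve 3 (λ x q p → x :* q :* p := x :* (p :* q)) refl

  p^-cancelʳ : ∀ N {x y} → x ℚ.* p^ (+ N) ≡ y ℚ.* p^ (+ N) → x ≡ y
  p^-cancelʳ N {x} {y} eq = fromℤ-cancelʳ (p ℕ.^ N) ⦃ ℕ.m^n≢0 p N ⦄
    (subst (λ q → x ℚ.* q ≡ y ℚ.* q) (sym (fromℤ-p^ N)) eq)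

  p^-+ : ∀ m n → p^ (+ (m ℕ.+ n)) ≡ p^ (+ m) ℚ.* p^ (+ n)
  p^-+ zero    n = sym (ℚ.*-identityˡ (p^ (+ n)))
  p^-+ (suc m) n = trans (cong (fromℤ (+ p) ℚ.*_) (p^-+ m n))
    (sym (ℚ.*-assoc (fromℤ (+ p)) (p^ (+ m)) (p^ (+ n))))

  ∼-refl : ∀ x → x ∼ x
  ∼-refl x = tends-to-0 λ k → 0 , λ n _ →
    subst (∣_∣ₚ≤p^ (ℤ.- (+ k))) (sym (ℚ.+-inverseʳ (x n))) (small-0 (ℤ.- (+ k)))

  ∼-sym : ∀ {x y} → x ∼ y → y ∼ x
  ∼-sym {x} {y} (tends-to-0 close) = tends-to-0 λ k → let N , f = close k in N , λ n N≤n →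
    subst (∣_∣ₚ≤p^ (ℤ.- (+ k)))
      (ℚ-Solver.solve 2 (λ x y → :- (x :- y) := y :- x) refl (x n) (y n))
      (small-neg {e = ℤ.- (+ k)} (f n N≤n))
    where open ℚ-Solver using (:-_; _:-_; _:=_)

  ∼-+ : ∀ {x y u v} → x ∼ y → u ∼ v → (λ n → x n ℚ.+ u n) ∼ (λ n → y n ℚ.+ v n)
  ∼-+ {x} {y} {u} {v} (tends-to-0 c) (tends-to-0 d) = tends-to-0 λ k →
    let M , f = c k
        N , g = d k
    in M ℕ.⊔ N , λ n ≤n → subst (∣_∣ₚ≤p^ (ℤ.- (+ k))) (+-diff (x n) (y n) (u n) (v n))
      (small-+ {e = ℤ.- (+ k)} (f n (ℕ.m⊔n≤o⇒m≤o M N ≤n)) (g n (ℕ.m⊔n≤o⇒n≤o M N ≤n)))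

  ∼-neg : ∀ {x y} → x ∼ y → (λ n → ℚ.- x n) ∼ (λ n → ℚ.- y n)
  ∼-neg {x} {y} (tends-to-0 c) = tends-to-0 λ k → let N , f = c k in N , λ n N≤n →
    subst (∣_∣ₚ≤p^ (ℤ.- (+ k))) (neg-diff (x n) (y n)) (small-neg {e = ℤ.- (+ k)} (f n N≤n))

  ∼-trans : ∀ {x y z} → x ∼ y → y ∼ z → x ∼ z
  ∼-trans {x} {y} {z} (tends-to-0 c) (tends-to-0 d) = tends-to-0 λ k →
    let M , f = c k
        N , g = d k
    in M ℕ.⊔ N , λ n ≤n → subst (∣_∣ₚ≤p^ (ℤ.- (+ k)))
      (ℚ-Solver.solve 3 (λ x y z → (x :- y) :+ (y :- z) := x :- z) refl (x n) (y n) (z n))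
      (small-+ {e = ℤ.- (+ k)} (f n (ℕ.m⊔n≤o⇒m≤o M N ≤n)) (g n (ℕ.m⊔n≤o⇒n≤o M N ≤n)))
    where open ℚ-Solver using (_:+_; _:-_; _:=_)

  -- The factor u enlarges absolute values by at most p^B, so closeness is requested to order B + k.
  ∼-*ˡ : ∀ u {x y} → x ∼ y → (λ n → u ℚ.* x n) ∼ (λ n → u ℚ.* y n)
  ∼-*ˡ u {x} {y} (tends-to-0 c) = tends-to-0 λ k →
    let B , u≤p^B = bounded u
        N , f = c (B ℕ.+ k)
    in N , λ n N≤n → subst (∣_∣ₚ≤p^ (ℤ.- (+ k)))
      (ℚ-Solver.solve 3 (λ u x y → u :* (x :- y) := u :* x :- u :* y) refl u (x n) (y n))
      (small-* B k u≤p^B (f n N≤n))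
    where open ℚ-Solver using (_:*_; _:-_; _:=_)

  [p∸1]/2≡h : (p ℕ.∸ 1) ℕ./ 2 ≡ h
  [p∸1]/2≡h = trans (cong (λ q → (q ℕ.∸ 1) ℕ./ 2) p≡1+2h)
    (trans (cong (ℕ._/ 2) (ℕ-Solver.solve 1 (λ h → h :+ h := h :* con 2) refl h)) (ℕ.m*n/n≡m h 2))
    where open ℕ-Solver using (_:+_; _:*_; _:=_; con)

  -- Both faces of a floor c: c is `numerator` / p^N with |c| ≤ p / 2 by `small`, while `rest` is
  -- the p-integral z with x - c = p z.
  record FloorData (b : ℚₚ) (x : ℚ) (N : ℕ) : Set where
    field
      value         : ℚ
      isFloor       : value isFloorₚOf b
      numerator     : ℤ
      value*p^      : value ℚ.* p^ (+ N) ≡ fromℤ numerator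
      small         : 2 ℕ.* ℤ.∣ numerator ∣ ℕ.≤ p ℕ.^ suc N
      rest          : ℚ
      rest-integral : Integral rest
      split         : x ≡ value ℚ.+ fromℤ (+ p) ℚ.* rest

  -- The number x p^N is p-integral, so its digits exist, and shifting them by N expands x. Its
  -- first N + 1 digits occupy the exponents -N, ..., 0; the tail after them, multiplied by p^(N+1)
  -- / p^N = p, is x - c.
  floorOfRational : ∀ b x N → seq b ∼ (λ _ → x) → Integral (x ℚ.* p^ (+ N)) → FloorData b x N
  floorOfRational b x N b∼x ix = record
    { value = s (suc N)
    ; isFloor = N , a , record
        { balanced = λ j → subst (ℤ.∣ a j ∣ ℕ.≤_) (sym [p∸1]/2≡h) (digits-balanced ℤ.∣ j ℤ.+ + N ∣)
        -- After n digits the error is p^(n-N) times a p-integral number, hence divisible by p^k as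
        -- soon as n ≥ N + k.
        ; converges = ∼-trans (∼-sym (tends-to-0 λ k → N ℕ.+ k , λ n N+k≤n → bound
            (subst Integral (sym (remainder k n N+k≤n))
              (integral-* (integral-p^ (n ℕ.∸ (N ℕ.+ k))) (proj₂ (tail n)))))) (∼-sym b∼x)
        } , refl
    ; numerator = prefix (suc N)
    ; value*p^ = partialSum-prefix (suc N)
    ; small = ℕ.<⇒≤ (prefix-bound (suc N))
    ; rest = proj₁ (tail (suc N))
    ; rest-integral = proj₂ (tail (suc N))
    ; split = p^-cancelʳ N (begin
        x ℚ.* p^ (+ N) ≡⟨ prefix-tail (suc N) ⟩
        fromℤ (prefix (suc N)) ℚ.+ p^ (+ suc N) ℚ.* proj₁ (tail (suc N))
          ≡⟨ cong (ℚ._+ p^ (+ suc N) ℚ.* proj₁ (tail (suc N))) (partialSum-prefix (suc N)) ⟨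
        s (suc N) ℚ.* p^ (+ N) ℚ.+ p^ (+ suc N) ℚ.* proj₁ (tail (suc N))
          ≡⟨ solve 4 (λ s q p w → s :* q :+ p :* q :* w := (s :+ p :* w) :* q) refl
               (s (suc N)) (p^ (+ N)) (fromℤ (+ p)) (proj₁ (tail (suc N))) ⟩
        (s (suc N) ℚ.+ fromℤ (+ p) ℚ.* proj₁ (tail (suc N))) ℚ.* p^ (+ N) ∎) }
    where
    open Expand (x ℚ.* p^ (+ N)) ix
    open ≡-Reasoning
    open ℚ-Solver using (solve; _:+_; _:*_; _:-_; _:=_)
    -- The absolute value only converts the index to ℕ: it changes nothing for j ≥ -N. Below -N,
    -- where the sum has not begun, any balanced value will do.
    a : ℤ → ℤ
    a j = digits ℤ.∣ j ℤ.+ + N ∣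
    s = partialSum N a
    a-⊖ : ∀ n → a (n ⊖ N) ≡ digits n
    a-⊖ n = cong (λ i → digits ℤ.∣ i ∣) (trans (cong (ℤ._+ + N) (sym (ℤ.m-n≡m⊖n n N)))
      (ℤ-Solver.solve 2 (λ n N → n I.:- N I.:+ N I.:= n) refl (+ n) (+ N)))
      where module I = ℤ-Solver
    partialSum-prefix : ∀ n → s n ℚ.* p^ (+ N) ≡ fromℤ (prefix n)
    partialSum-prefix zero    = ℚ.*-zeroˡ (p^ (+ N))
    partialSum-prefix (suc n) = begin
      (s n ℚ.+ fromℤ (a (n ⊖ N)) ℚ.* p^ (n ⊖ N)) ℚ.* p^ (+ N)
        ≡⟨ solve 4 (λ s a q r → (s :+ a :* q) :* r := s :* r :+ a :* (q :* r)) refl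
             (s n) (fromℤ (a (n ⊖ N))) (p^ (n ⊖ N)) (p^ (+ N)) ⟩
      s n ℚ.* p^ (+ N) ℚ.+ fromℤ (a (n ⊖ N)) ℚ.* (p^ (n ⊖ N) ℚ.* p^ (+ N))
        ≡⟨ cong₂ (λ u v → u ℚ.+ fromℤ (a (n ⊖ N)) ℚ.* v) (partialSum-prefix n) (p^-⊖ n N) ⟩
      fromℤ (prefix n) ℚ.+ fromℤ (a (n ⊖ N)) ℚ.* p^ (+ n)
        ≡⟨ cong (λ i → fromℤ (prefix n) ℚ.+ fromℤ i ℚ.* p^ (+ n)) (a-⊖ n) ⟩
      fromℤ (prefix n) ℚ.+ fromℤ (digits n) ℚ.* p^ (+ n) ≡⟨ fromℤ-prefix n ⟨
      fromℤ (prefix (suc n)) ∎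
    remainder : ∀ k n → N ℕ.+ k ℕ.≤ n →
      (x ℚ.- s n) ℚ.* p^ (ℤ.- (+ k)) ≡ p^ (+ (n ℕ.∸ (N ℕ.+ k))) ℚ.* proj₁ (tail n)
    remainder k n N+k≤n = begin
      (x ℚ.- s n) ℚ.* p^ (ℤ.- (+ k))
        -- Writing p^(-k) as p^N p^(-(N+k)) supplies the p^N that turns x and the partial sum into
        -- quantities known from the digits of x p^N.
        ≡⟨ cong ((x ℚ.- s n) ℚ.*_) (trans (p^-neg k) (sym (p⁻-cancel N k))) ⟩
      (x ℚ.- s n) ℚ.* (p^ (+ N) ℚ.* r)
        ≡⟨ solve 4 (λ x s q r → (x :- s) :* (q :* r) := (x :* q :- s :* q) :* r) refl x (s n) (p^ (+ N)) r ⟩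
      (x ℚ.* p^ (+ N) ℚ.- s n ℚ.* p^ (+ N)) ℚ.* r
        ≡⟨ cong₂ (λ u v → (u ℚ.- v) ℚ.* r) (prefix-tail n) (partialSum-prefix n) ⟩
      (fromℤ (prefix n) ℚ.+ p^ (+ n) ℚ.* w ℚ.- fromℤ (prefix n)) ℚ.* r
        ≡⟨ solve 4 (λ i q w r → (i :+ q :* w :- i) :* r := q :* (w :* r)) refl
             (fromℤ (prefix n)) (p^ (+ n)) w r ⟩
      p^ (+ n) ℚ.* (w ℚ.* r)
        ≡⟨ cong (ℚ._* (w ℚ.* r))
             (trans (cong (λ i → p^ (+ i)) (sym (ℕ.m+[n∸m]≡n N+k≤n))) (p^-+ (N ℕ.+ k) m)) ⟩
      p^ (+ (N ℕ.+ k)) ℚ.* p^ (+ m) ℚ.* (w ℚ.* r)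
        ≡⟨ solve 4 (λ f q w r → f :* q :* (w :* r) := (f :* r) :* (q :* w)) refl
             (p^ (+ (N ℕ.+ k))) (p^ (+ m)) w r ⟩
      p^ (+ (N ℕ.+ k)) ℚ.* r ℚ.* (p^ (+ m) ℚ.* w) ≡⟨ cong (ℚ._* (p^ (+ m) ℚ.* w)) (p^*p⁻ (N ℕ.+ k)) ⟩
      1ℚ ℚ.* (p^ (+ m) ℚ.* w) ≡⟨ ℚ.*-identityˡ (p^ (+ m) ℚ.* w) ⟩
      p^ (+ m) ℚ.* w ∎
      where
      r = p⁻ (N ℕ.+ k)
      m = n ℕ.∸ (N ℕ.+ k)
      w = proj₁ (tail n)

-- Arithmetic of ℚ(γ) in coordinates.

module Quadratic where
  open import Data.Rational.Base using (_+_; _*_; _-_; -_)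
  open ℚ-Solver
  open Norm using (norm; mul₀; mul₁)

  -- `re` and `im` are the coordinates of (a + b γ)(c + d γ). Leaving t a variable lets one
  -- polynomial identity serve both generators.
  re : (a b c d : ℚ) → ℚ
  re a b c d = a * c - b * d

  im : (t a b c d : ℚ) → ℚ
  im t a b c d = a * d + b * c - t * (b * d)

  normℚ : (t a b : ℚ) → ℚ
  normℚ t a b = a * a - t * (a * b) + b * b

  private
    rePoly : ∀ {n} (a b c d : Polynomial n) → Polynomial n
    rePoly a b c d = a :* c :- b :* d
    imPoly : ∀ {n} (t a b c d : Polynomial n) → Polynomial n
    imPoly t a b c d = a :* d :+ b :* c :- t :* (b :* d)
    normPoly : ∀ {n} (t a b : Polynomial n) → Polynomial n
    normPoly t a b = a :* a :- t :* (a :* b) :+ b :* b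

  fromℤ-mul₀ : ∀ a b c d → fromℤ (mul₀ (a , b) (c , d)) ≡ re (fromℤ a) (fromℤ b) (fromℤ c) (fromℤ d)
  fromℤ-mul₀ a b c d = trans (fromℤ-minus (a ℤ.* c) (b ℤ.* d)) (cong₂ _-_ (fromℤ-* a c) (fromℤ-* b d))

  fromℤ-mul₁ : ∀ t a b c d → fromℤ (mul₁ t (a , b) (c , d)) ≡
    im (fromℤ t) (fromℤ a) (fromℤ b) (fromℤ c) (fromℤ d)
  fromℤ-mul₁ t a b c d = trans (fromℤ-minus (a ℤ.* d ℤ.+ b ℤ.* c) (t ℤ.* (b ℤ.* d)))
    (cong₂ _-_ (trans (fromℤ-+ (a ℤ.* d) (b ℤ.* c)) (cong₂ _+_ (fromℤ-* a d) (fromℤ-* b c)))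
      (trans (fromℤ-* t (b ℤ.* d)) (cong (fromℤ t *_) (fromℤ-* b d))))

  fromℤ-norm : ∀ t a b → fromℤ (norm t (a , b)) ≡ normℚ (fromℤ t) (fromℤ a) (fromℤ b)
  fromℤ-norm t a b = trans (fromℤ-+ (a ℤ.* a ℤ.- t ℤ.* (a ℤ.* b)) (b ℤ.* b))
    (cong₂ _+_ (trans (fromℤ-minus (a ℤ.* a) (t ℤ.* (a ℤ.* b)))
        (cong₂ _-_ (fromℤ-* a a) (trans (fromℤ-* t (a ℤ.* b)) (cong (fromℤ t *_) (fromℤ-* a b)))))
      (fromℤ-* b b))

  -- With α = c + p z and P = p α Q this is p² (z Q) = P - p c Q, multiplied by f so that c f can
  -- become an integer.
  re-remainder : ∀ f p c₀ c₁ z₀ z₁ q₀ q₁ →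
    re z₀ z₁ q₀ q₁ * (p * (p * f)) ≡
    f * (p * re (c₀ + p * z₀) (c₁ + p * z₁) q₀ q₁) - re (p * (c₀ * f)) (p * (c₁ * f)) q₀ q₁
  re-remainder = solve 8 (λ f p c₀ c₁ z₀ z₁ q₀ q₁ →
    rePoly z₀ z₁ q₀ q₁ :* (p :* (p :* f)) :=
    f :* (p :* rePoly (c₀ :+ p :* z₀) (c₁ :+ p :* z₁) q₀ q₁) :-
      rePoly (p :* (c₀ :* f)) (p :* (c₁ :* f)) q₀ q₁) refl

  im-remainder : ∀ t f p c₀ c₁ z₀ z₁ q₀ q₁ →
    im t z₀ z₁ q₀ q₁ * (p * (p * f)) ≡
    f * (p * im t (c₀ + p * z₀) (c₁ + p * z₁) q₀ q₁) - im t (p * (c₀ * f)) (p * (c₁ * f)) q₀ q₁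
  im-remainder = solve 9 (λ t f p c₀ c₁ z₀ z₁ q₀ q₁ →
    imPoly t z₀ z₁ q₀ q₁ :* (p :* (p :* f)) :=
    f :* (p :* imPoly t (c₀ :+ p :* z₀) (c₁ :+ p :* z₁) q₀ q₁) :-
      imPoly t (p :* (c₀ :* f)) (p :* (c₁ :* f)) q₀ q₁) refl

  -- Multiplication by the conjugate (q₀ - t q₁) - q₁ γ of q₀ + q₁ γ.
  conj₀ : (t a b q₀ q₁ : ℚ) → ℚ
  conj₀ t a b q₀ q₁ = a * (q₀ - t * q₁) + b * q₁

  conj₁ : (a b q₀ q₁ : ℚ) → ℚ
  conj₁ a b q₀ q₁ = b * q₀ - a * q₁

  private
    c₀Poly : ∀ {n} (t a b c d : Polynomial n) → Polynomial n
    c₀Poly t a b q₀ q₁ = a :* (q₀ :- t :* q₁) :+ b :* q₁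
    c₁Poly : ∀ {n} (a b c d : Polynomial n) → Polynomial n
    c₁Poly a b q₀ q₁ = b :* q₀ :- a :* q₁

  -- Multiplying z Q by the conjugate of Q leaves z N(Q), so z Q = 0 forces z = 0 when N(Q) ≠ 0.
  conj₀-cancel : ∀ t a b c d → conj₀ t (re a b c d) (im t a b c d) c d ≡ a * normℚ t c d
  conj₀-cancel = solve 5 (λ t a b c d →
    c₀Poly t (rePoly a b c d) (imPoly t a b c d) c d := a :* normPoly t c d) refl

  conj₁-cancel : ∀ t a b c d → conj₁ (re a b c d) (im t a b c d) c d ≡ b * normℚ t c d
  conj₁-cancel = solve 5 (λ t a b c d →
    c₁Poly (rePoly a b c d) (imPoly t a b c d) c d := b :* normPoly t c d) refl

  conj₀-self : ∀ t c d → conj₀ t c d c d ≡ normℚ t c d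
  conj₀-self = solve 3 (λ t c d → c₀Poly t c d c d := normPoly t c d) refl

  conj₁-self : ∀ c d → conj₁ c d c d ≡ 0ℚ
  conj₁-self = solve 2 (λ c d → c₁Poly c d c d := con 0ℚ) refl

  -- The product of s Q R' with p z, where R' is the conjugate of R, regrouped as s p (z Q) R'. Once
  -- z Q = R it equals s p N(R).
  re-conj : ∀ t s p q₀ q₁ r₀ r₁ z₀ z₁ →
    re (s * conj₀ t q₀ q₁ r₀ r₁) (s * conj₁ q₀ q₁ r₀ r₁) (p * z₀) (p * z₁) ≡
    s * p * conj₀ t (re z₀ z₁ q₀ q₁) (im t z₀ z₁ q₀ q₁) r₀ r₁
  re-conj = solve 9 (λ t s p q₀ q₁ r₀ r₁ z₀ z₁ →
    rePoly (s :* c₀Poly t q₀ q₁ r₀ r₁) (s :* c₁Poly q₀ q₁ r₀ r₁) (p :* z₀) (p :* z₁) :=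
    s :* p :* c₀Poly t (rePoly z₀ z₁ q₀ q₁) (imPoly t z₀ z₁ q₀ q₁) r₀ r₁) refl

  im-conj : ∀ t s p q₀ q₁ r₀ r₁ z₀ z₁ →
    im t (s * conj₀ t q₀ q₁ r₀ r₁) (s * conj₁ q₀ q₁ r₀ r₁) (p * z₀) (p * z₁) ≡
    s * p * conj₁ (re z₀ z₁ q₀ q₁) (im t z₀ z₁ q₀ q₁) r₀ r₁
  im-conj = solve 9 (λ t s p q₀ q₁ r₀ r₁ z₀ z₁ →
    imPoly t (s :* c₀Poly t q₀ q₁ r₀ r₁) (s :* c₁Poly q₀ q₁ r₀ r₁) (p :* z₀) (p :* z₁) :=
    s :* p :* c₁Poly (rePoly z₀ z₁ q₀ q₁) (imPoly t z₀ z₁ q₀ q₁) r₀ r₁) refl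

  -- For β = s Q R', with R' the conjugate of R, this computes p β R = s p N(R) Q, which is Q for
  -- the right s.
  re-conj-cancel : ∀ t s p a b c d →
    p * re (s * conj₀ t a b c d) (s * conj₁ a b c d) c d ≡ s * p * normℚ t c d * a
  re-conj-cancel = solve 7 (λ t s p a b c d →
    p :* rePoly (s :* c₀Poly t a b c d) (s :* c₁Poly a b c d) c d :=
    s :* p :* normPoly t c d :* a) refl

  im-conj-cancel : ∀ t s p a b c d →
    p * im t (s * conj₀ t a b c d) (s * conj₁ a b c d) c d ≡ s * p * normℚ t c d * b
  im-conj-cancel = solve 7 (λ t s p a b c d →
    p :* imPoly t (s :* c₀Poly t a b c d) (s :* c₁Poly a b c d) c d :=
    s :* p :* normPoly t c d :* b) refl

-- The descent along the continued fraction expansion.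

module Expansions (p : ℕ) (p-prime : Prime p) (h : ℕ) (p≡1+2h : p ≡ suc (h ℕ.+ h))
                  (γ : Generator) where
  open Extension p p-prime γ
  open Padic p p-prime
  open Digits p p-prime h p≡1+2h using (fromℤ-p^)
  open Floors p p-prime h p≡1+2h
  open Norm
  open Quadratic

  private
    t = coeff γ
    τ = fromℤ t
    pℚ = fromℤ (+ p)

  3≤p : 3 ℕ.≤ p
  3≤p = subst (3 ℕ.≤_) (sym p≡1+2h) (ℕ.s≤s (ℕ.+-mono-≤ 1≤h 1≤h))
    where
    1≤h : 1 ℕ.≤ h
    1≤h = ℕ.n≢0⇒n>0 λ { refl → p≢1 p≡1+2h }

  integral-fromℤ : ∀ i → Integral (fromℤ i)
  integral-fromℤ i = integral-/ i 1 λ p∣1 → p≢1 (∣1⇒≡1 p∣1)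

  -- Carries an inverse found in ℚ(γ) over to K, where α merely converges to x + y γ. The generators
  -- are separated because `mul` writes its reduction without the factor t.
  inverse-of-remainder : ∀ {a b} x y c₀ c₁ u v → (a +γ b) ≈ fromℚ² x y →
    re u v (x ℚ.- c₀) (y ℚ.- c₁) ≡ 1ℚ → im τ u v (x ℚ.- c₀) (y ℚ.- c₁) ≡ 0ℚ →
    fromℚ² u v * ((a +γ b) - fromℚ² c₀ c₁) ≈ 1K
  inverse-of-remainder {a} {b} x y c₀ c₁ u v (a∼x , b∼y) eq₀ eq₁ = by-generator γ eq₁
    where
    x∼ : (λ n → seq a n ℚ.- c₀) ∼ (λ _ → x ℚ.- c₀)
    x∼ = ∼-+ a∼x (∼-refl (λ _ → ℚ.- c₀))
    y∼ : (λ n → seq b n ℚ.- c₁) ∼ (λ _ → y ℚ.- c₁)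
    y∼ = ∼-+ b∼y (∼-refl (λ _ → ℚ.- c₁))
    X = x ℚ.- c₀
    Y = y ℚ.- c₁
    to : ∀ {s z z′} → s ∼ (λ _ → z) → z ≡ z′ → s ∼ (λ _ → z′)
    to {s} s∼z eq = subst (λ z → s ∼ (λ _ → z)) eq s∼z
    real : (λ n → u ℚ.* (seq a n ℚ.- c₀) ℚ.- v ℚ.* (seq b n ℚ.- c₁)) ∼ (λ _ → 1ℚ)
    real = to (∼-+ (∼-*ˡ u x∼) (∼-neg (∼-*ˡ v y∼))) eq₀
    mixed : (λ n → u ℚ.* (seq b n ℚ.- c₁) ℚ.+ v ℚ.* (seq a n ℚ.- c₀)) ∼ (λ _ → u ℚ.* Y ℚ.+ v ℚ.* X)
    mixed = ∼-+ (∼-*ˡ u y∼) (∼-*ˡ v x∼)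
    by-generator : ∀ g → im (fromℤ (coeff g)) u v X Y ≡ 0ℚ →
      mul g (fromℚ² u v) ((a +γ b) - fromℚ² c₀ c₁) ≈ 1K
    by-generator ι eq = real , to mixed (trans
      (solve 2 (λ s m → s := s :- con 0ℚ :* m) refl (u ℚ.* Y ℚ.+ v ℚ.* X) (v ℚ.* Y)) eq)
      where open ℚ-Solver
    by-generator ω eq = real , to (∼-+ mixed (∼-neg (∼-*ˡ v y∼))) (trans
      (solve 2 (λ s m → s :- m := s :- con 1ℚ :* m) refl (u ℚ.* Y ℚ.+ v ℚ.* X) (v ℚ.* Y)) eq)
      where open ℚ-Solver

  remainder-eq : ∀ x c z → x ≡ c ℚ.+ pℚ ℚ.* z → x ℚ.- c ≡ pℚ ℚ.* z
  remainder-eq x c z eq = trans (cong (ℚ._- c) eq)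
    (solve 2 (λ c w → c :+ w :- c := w) refl c (pℚ ℚ.* z))
    where open ℚ-Solver

  -- The sum of the two exponents serves both coordinates, so that their floors share one
  -- denominator p^N.
  bounded₂ : ∀ x y → ∃ λ N → Integral (x ℚ.* p^ (+ N)) × Integral (y ℚ.* p^ (+ N))
  bounded₂ x y =
    let A , bx = bounded x
        B , by = bounded y
    in A ℕ.+ B ,
      subst Integral (eq₁ A B) (integral-* (integral bx) (integral-p^ B)) ,
      subst Integral (eq₂ A B) (integral-* (integral by) (integral-p^ A))
    where
    open ℚ-Solver
    eq₁ : ∀ A B → x ℚ.* p^ (+ A) ℚ.* p^ (+ B) ≡ x ℚ.* p^ (+ (A ℕ.+ B))
    eq₁ A B = trans (ℚ.*-assoc x (p^ (+ A)) (p^ (+ B))) (cong (x ℚ.*_) (sym (p^-+ A B)))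
    eq₂ : ∀ A B → y ℚ.* p^ (+ B) ℚ.* p^ (+ A) ≡ y ℚ.* p^ (+ (A ℕ.+ B))
    eq₂ A B = trans (solve 3 (λ y a b → y :* b :* a := y :* (a :* b)) refl y (p^ (+ A)) (p^ (+ B)))
      (cong (y ℚ.*_) (sym (p^-+ A B)))

  -- α p Q = P for α = x + y γ, P = P₀ + P₁ γ and Q = Q₀ + Q₁ γ.
  record Fraction (x y : ℚ) (P₀ P₁ Q₀ Q₁ : ℤ) : Set where
    constructor fraction
    field
      eq₀ : fromℤ P₀ ≡ pℚ ℚ.* re x y (fromℤ Q₀) (fromℤ Q₁)
      eq₁ : fromℤ P₁ ≡ pℚ ℚ.* im τ x y (fromℤ Q₀) (fromℤ Q₁)

  module Step {a b x y P₀ P₁ Q₀ Q₁} (α∼ : (a +γ b) ≈ fromℚ² x y)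
              (α=P/pQ : Fraction x y P₀ P₁ Q₀ Q₁) (0<Q : + 0 ℤ.< norm t (Q₀ , Q₁))
              (N : ℕ) (F₀ : FloorData a x N) (F₁ : FloorData b y N) where
    module F₀ = FloorData F₀
    module F₁ = FloorData F₁
    c₀ = F₀.value
    c₁ = F₁.value
    z₀ = F₀.rest
    z₁ = F₁.rest
    q₀ = fromℤ Q₀
    q₁ = fromℤ Q₁
    -- The factor p makes G / p^(2+N) equal to c / p, the coefficient of Q in R.
    G₀ = + p ℤ.* F₀.numerator
    G₁ = + p ℤ.* F₁.numerator

    α-floor : (fromℚ² c₀ c₁) isFloorOf (a +γ b)
    α-floor = floor F₀.isFloor F₁.isFloor

    re-integral : Integral (re z₀ z₁ q₀ q₁)
    re-integral = integral-+ (integral-* F₀.rest-integral (integral-fromℤ Q₀))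
      (integral-neg (integral-* F₁.rest-integral (integral-fromℤ Q₁)))

    im-integral : Integral (im τ z₀ z₁ q₀ q₁)
    im-integral = integral-+ (integral-+ (integral-* F₀.rest-integral (integral-fromℤ Q₁))
        (integral-* F₁.rest-integral (integral-fromℤ Q₀)))
      (integral-neg (integral-* (integral-fromℤ t) (integral-* F₁.rest-integral (integral-fromℤ Q₁))))

    -- The integer form of p^(2+N) z Q: a factor p² from the formula for R, and p^N from the
    -- denominator of c.
    T₀ = + (p ℕ.^ N) ℤ.* P₀ ℤ.- mul₀ (G₀ , G₁) (Q₀ , Q₁)
    T₁ = + (p ℕ.^ N) ℤ.* P₁ ℤ.- mul₁ t (G₀ , G₁) (Q₀ , Q₁)
    f = p^ (+ N)

    numerators : ∀ c C → c ℚ.* f ≡ fromℤ C → pℚ ℚ.* (c ℚ.* f) ≡ fromℤ (+ p ℤ.* C)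
    numerators c C eq = trans (cong (pℚ ℚ.*_) eq) (sym (fromℤ-* (+ p) C))

    re-eq : re z₀ z₁ q₀ q₁ ℚ.* p^ (+ (2 ℕ.+ N)) ≡ fromℤ T₀
    re-eq = begin
      re z₀ z₁ q₀ q₁ ℚ.* (pℚ ℚ.* (pℚ ℚ.* f)) ≡⟨ re-remainder f pℚ c₀ c₁ z₀ z₁ q₀ q₁ ⟩
      f ℚ.* (pℚ ℚ.* re (c₀ ℚ.+ pℚ ℚ.* z₀) (c₁ ℚ.+ pℚ ℚ.* z₁) q₀ q₁) ℚ.-
        re (pℚ ℚ.* (c₀ ℚ.* f)) (pℚ ℚ.* (c₁ ℚ.* f)) q₀ q₁
        ≡⟨ cong₂ (λ u v → f ℚ.* (pℚ ℚ.* re u v q₀ q₁) ℚ.-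
             re (pℚ ℚ.* (c₀ ℚ.* f)) (pℚ ℚ.* (c₁ ℚ.* f)) q₀ q₁) F₀.split F₁.split ⟨
      f ℚ.* (pℚ ℚ.* re x y q₀ q₁) ℚ.- re (pℚ ℚ.* (c₀ ℚ.* f)) (pℚ ℚ.* (c₁ ℚ.* f)) q₀ q₁
        ≡⟨ cong₂ (λ u v → f ℚ.* (pℚ ℚ.* re x y q₀ q₁) ℚ.- re u v q₀ q₁)
             (numerators c₀ F₀.numerator F₀.value*p^) (numerators c₁ F₁.numerator F₁.value*p^) ⟩
      f ℚ.* (pℚ ℚ.* re x y q₀ q₁) ℚ.- re (fromℤ G₀) (fromℤ G₁) q₀ q₁
        ≡⟨ cong₂ (λ u v → f ℚ.* u ℚ.- v) (Fraction.eq₀ α=P/pQ) (fromℤ-mul₀ G₀ G₁ Q₀ Q₁) ⟨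
      f ℚ.* fromℤ P₀ ℚ.- fromℤ (mul₀ (G₀ , G₁) (Q₀ , Q₁))
        ≡⟨ cong (λ u → u ℚ.* fromℤ P₀ ℚ.- fromℤ (mul₀ (G₀ , G₁) (Q₀ , Q₁))) (fromℤ-p^ N) ⟨
      fromℤ (+ (p ℕ.^ N)) ℚ.* fromℤ P₀ ℚ.- fromℤ (mul₀ (G₀ , G₁) (Q₀ , Q₁))
        ≡⟨ cong (ℚ._- fromℤ (mul₀ (G₀ , G₁) (Q₀ , Q₁))) (fromℤ-* (+ (p ℕ.^ N)) P₀) ⟨
      fromℤ (+ (p ℕ.^ N) ℤ.* P₀) ℚ.- fromℤ (mul₀ (G₀ , G₁) (Q₀ , Q₁))
        ≡⟨ fromℤ-minus (+ (p ℕ.^ N) ℤ.* P₀) (mul₀ (G₀ , G₁) (Q₀ , Q₁)) ⟨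
      fromℤ T₀ ∎
      where open ≡-Reasoning

    im-eq : im τ z₀ z₁ q₀ q₁ ℚ.* p^ (+ (2 ℕ.+ N)) ≡ fromℤ T₁
    im-eq = begin
      im τ z₀ z₁ q₀ q₁ ℚ.* (pℚ ℚ.* (pℚ ℚ.* f)) ≡⟨ im-remainder τ f pℚ c₀ c₁ z₀ z₁ q₀ q₁ ⟩
      f ℚ.* (pℚ ℚ.* im τ (c₀ ℚ.+ pℚ ℚ.* z₀) (c₁ ℚ.+ pℚ ℚ.* z₁) q₀ q₁) ℚ.-
        im τ (pℚ ℚ.* (c₀ ℚ.* f)) (pℚ ℚ.* (c₁ ℚ.* f)) q₀ q₁
        ≡⟨ cong₂ (λ u v → f ℚ.* (pℚ ℚ.* im τ u v q₀ q₁) ℚ.-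
             im τ (pℚ ℚ.* (c₀ ℚ.* f)) (pℚ ℚ.* (c₁ ℚ.* f)) q₀ q₁) F₀.split F₁.split ⟨
      f ℚ.* (pℚ ℚ.* im τ x y q₀ q₁) ℚ.- im τ (pℚ ℚ.* (c₀ ℚ.* f)) (pℚ ℚ.* (c₁ ℚ.* f)) q₀ q₁
        ≡⟨ cong₂ (λ u v → f ℚ.* (pℚ ℚ.* im τ x y q₀ q₁) ℚ.- im τ u v q₀ q₁)
             (numerators c₀ F₀.numerator F₀.value*p^) (numerators c₁ F₁.numerator F₁.value*p^) ⟩
      f ℚ.* (pℚ ℚ.* im τ x y q₀ q₁) ℚ.- im τ (fromℤ G₀) (fromℤ G₁) q₀ q₁
        ≡⟨ cong₂ (λ u v → f ℚ.* u ℚ.- v) (Fraction.eq₁ α=P/pQ) (fromℤ-mul₁ t G₀ G₁ Q₀ Q₁) ⟨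
      f ℚ.* fromℤ P₁ ℚ.- fromℤ (mul₁ t (G₀ , G₁) (Q₀ , Q₁))
        ≡⟨ cong (λ u → u ℚ.* fromℤ P₁ ℚ.- fromℤ (mul₁ t (G₀ , G₁) (Q₀ , Q₁))) (fromℤ-p^ N) ⟨
      fromℤ (+ (p ℕ.^ N)) ℚ.* fromℤ P₁ ℚ.- fromℤ (mul₁ t (G₀ , G₁) (Q₀ , Q₁))
        ≡⟨ cong (ℚ._- fromℤ (mul₁ t (G₀ , G₁) (Q₀ , Q₁))) (fromℤ-* (+ (p ℕ.^ N)) P₁) ⟨
      fromℤ (+ (p ℕ.^ N) ℤ.* P₁) ℚ.- fromℤ (mul₁ t (G₀ , G₁) (Q₀ , Q₁))
        ≡⟨ fromℤ-minus (+ (p ℕ.^ N) ℤ.* P₁) (mul₁ t (G₀ , G₁) (Q₀ , Q₁)) ⟨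
      fromℤ T₁ ∎
      where open ≡-Reasoning

    R₀-integer = integer-of-p^* (2 ℕ.+ N) re-integral T₀ re-eq
    R₁-integer = integer-of-p^* (2 ℕ.+ N) im-integral T₁ im-eq
    R₀ = proj₁ R₀-integer
    R₁ = proj₁ R₁-integer
    r₀ = fromℤ R₀
    r₁ = fromℤ R₁

    re≡R₀ : re z₀ z₁ q₀ q₁ ≡ r₀
    re≡R₀ = proj₂ R₀-integer
    im≡R₁ : im τ z₀ z₁ q₀ q₁ ≡ r₁
    im≡R₁ = proj₂ R₁-integer

    scaled : ∀ R w i → w ≡ fromℤ R → w ℚ.* p^ (+ (2 ℕ.+ N)) ≡ fromℤ i → + (p ℕ.^ (2 ℕ.+ N)) ℤ.* R ≡ i
    scaled R w i w≡R eq = fromℤ-injective (begin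
      fromℤ (+ (p ℕ.^ (2 ℕ.+ N)) ℤ.* R) ≡⟨ fromℤ-* (+ (p ℕ.^ (2 ℕ.+ N))) R ⟩
      fromℤ (+ (p ℕ.^ (2 ℕ.+ N))) ℚ.* fromℤ R ≡⟨ cong₂ ℚ._*_ (fromℤ-p^ (2 ℕ.+ N)) (sym w≡R) ⟩
      p^ (+ (2 ℕ.+ N)) ℚ.* w ≡⟨ ℚ.*-comm (p^ (+ (2 ℕ.+ N))) w ⟩
      w ℚ.* p^ (+ (2 ℕ.+ N)) ≡⟨ eq ⟩
      fromℤ i ∎)
      where open ≡-Reasoning

    G-small : ∀ C → 2 ℕ.* ℤ.∣ C ∣ ℕ.≤ p ℕ.^ suc N → ℤ.∣ + 2 ℤ.* (+ p ℤ.* C) ∣ ℕ.≤ p ℕ.^ (2 ℕ.+ N)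
    G-small C 2C≤ = subst (ℕ._≤ p ℕ.^ (2 ℕ.+ N)) (begin
      p ℕ.* (2 ℕ.* ℤ.∣ C ∣)
        ≡⟨ solve 2 (λ p c → p :* (con 2 :* c) := con 2 :* (p :* c)) refl p ℤ.∣ C ∣ ⟩
      2 ℕ.* (p ℕ.* ℤ.∣ C ∣)    ≡⟨ cong (2 ℕ.*_) (ℤ.abs-* (+ p) C) ⟨
      2 ℕ.* ℤ.∣ + p ℤ.* C ∣    ≡⟨ ℤ.abs-* (+ 2) (+ p ℤ.* C) ⟨
      ℤ.∣ + 2 ℤ.* (+ p ℤ.* C) ∣ ∎) (ℕ.*-monoʳ-≤ p 2C≤)
      where
      open ≡-Reasoning
      open ℕ-Solver

    9p^N≤p^[2+N] : 9 ℕ.* p ℕ.^ N ℕ.≤ p ℕ.^ (2 ℕ.+ N)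
    9p^N≤p^[2+N] = subst (9 ℕ.* p ℕ.^ N ℕ.≤_) (ℕ.*-assoc p p (p ℕ.^ N))
      (ℕ.*-monoˡ-≤ (p ℕ.^ N) (ℕ.*-mono-≤ 3≤p 3≤p))

    decrease : + 10 ℤ.* norm t (R₀ , R₁) ℤ.+ norm t (Q₀ , Q₁) ℤ.<
               + 10 ℤ.* norm t (Q₀ , Q₁) ℤ.+ norm t (P₀ , P₁)
    decrease = descent γ (p ℕ.^ N) (p ℕ.^ (2 ℕ.+ N)) G₀ G₁ P₀ P₁ (Q₀ , Q₁) R₀ R₁
      (ℕ.m^n>0 p (2 ℕ.+ N)) 9p^N≤p^[2+N] (G-small F₀.numerator F₀.small) (G-small F₁.numerator F₁.small)
      0<Q (scaled R₀ (re z₀ z₁ q₀ q₁) T₀ re≡R₀ re-eq) (scaled R₁ (im τ z₀ z₁ q₀ q₁) T₁ im≡R₁ im-eq)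

    normQ : ℕ
    normQ = ℤ.∣ norm t (Q₀ , Q₁) ∣

    stops : R₀ ≡ + 0 → R₁ ≡ + 0 → FiniteExpansion (a +γ b)
    stops R₀≡0 R₁≡0 = stop (fromℚ² c₀ c₁) α-floor
      (subst (λ x → seq a ∼ (λ _ → x)) (x≡c x c₀ z₀ F₀.split z₀≡0) (proj₁ α∼) ,
       subst (λ y → seq b ∼ (λ _ → y)) (x≡c y c₁ z₁ F₁.split z₁≡0) (proj₂ α∼))
      where
      x≡c : ∀ x c z → x ≡ c ℚ.+ pℚ ℚ.* z → z ≡ 0ℚ → x ≡ c
      x≡c x c z eq z≡0 = trans eq (trans (cong (λ z → c ℚ.+ pℚ ℚ.* z) z≡0)
        (trans (cong (c ℚ.+_) (ℚ.*-zeroʳ pℚ)) (ℚ.+-identityʳ c)))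
      cancel-norm : ∀ z → z ℚ.* normℚ τ q₀ q₁ ≡ 0ℚ → z ≡ 0ℚ
      cancel-norm z eq = fromℤ-cancelʳ normQ ⦃ ℤ.>-nonZero 0<Q ⦄
        (trans (cong (z ℚ.*_) (trans (cong fromℤ (ℤ.0≤i⇒+∣i∣≡i (ℤ.<⇒≤ 0<Q))) (fromℤ-norm t Q₀ Q₁)))
          (trans eq (sym (ℚ.*-zeroˡ (fromℤ (+ normQ))))))
      re≡0 : re z₀ z₁ q₀ q₁ ≡ 0ℚ
      re≡0 = trans re≡R₀ (cong fromℤ R₀≡0)
      im≡0 : im τ z₀ z₁ q₀ q₁ ≡ 0ℚ
      im≡0 = trans im≡R₁ (cong fromℤ R₁≡0)
      z₀≡0 : z₀ ≡ 0ℚ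
      z₀≡0 = cancel-norm z₀ (trans (sym (conj₀-cancel τ z₀ z₁ q₀ q₁))
        (trans (cong₂ (λ u v → conj₀ τ u v q₀ q₁) re≡0 im≡0)
          (solve 2 (λ u v → con 0ℚ :* u :+ con 0ℚ :* v := con 0ℚ) refl (q₀ ℚ.- τ ℚ.* q₁) q₁)))
        where open ℚ-Solver
      z₁≡0 : z₁ ≡ 0ℚ
      z₁≡0 = cancel-norm z₁ (trans (sym (conj₁-cancel τ z₀ z₁ q₀ q₁))
        (trans (cong₂ (λ u v → conj₁ u v q₀ q₁) re≡0 im≡0)
          (solve 2 (λ u v → con 0ℚ :* u :- con 0ℚ :* v := con 0ℚ) refl q₀ q₁)))
        where open ℚ-Solver

    module Next (0<R : + 0 ℤ.< norm t (R₀ , R₁)) where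
      normR : ℕ
      normR = ℤ.∣ norm t (R₀ , R₁) ∣
      instance
        normR≢0 : NonZero normR
        normR≢0 = ℤ.>-nonZero 0<R
        p*normR≢0 : NonZero (p ℕ.* normR)
        p*normR≢0 = ℕ.m*n≢0 p normR

      -- The inverse of p z is Q / (p R); expanding by the conjugate of R makes the denominator the
      -- integer p N(R).
      s = + 1 / (p ℕ.* normR)
      u = s ℚ.* conj₀ τ q₀ q₁ r₀ r₁
      v = s ℚ.* conj₁ q₀ q₁ r₀ r₁

      sp-norm : s ℚ.* pℚ ℚ.* normℚ τ r₀ r₁ ≡ 1ℚ
      sp-norm = begin
        s ℚ.* pℚ ℚ.* normℚ τ r₀ r₁ ≡⟨ cong (s ℚ.* pℚ ℚ.*_) (fromℤ-norm t R₀ R₁) ⟨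
        s ℚ.* pℚ ℚ.* fromℤ (norm t (R₀ , R₁)) ≡⟨ ℚ.*-assoc s pℚ (fromℤ (norm t (R₀ , R₁))) ⟩
        s ℚ.* (pℚ ℚ.* fromℤ (norm t (R₀ , R₁))) ≡⟨ cong (s ℚ.*_) (fromℤ-* (+ p) (norm t (R₀ , R₁))) ⟨
        s ℚ.* fromℤ (+ p ℤ.* norm t (R₀ , R₁))
          ≡⟨ cong (λ i → s ℚ.* fromℤ (+ p ℤ.* i)) (ℤ.0≤i⇒+∣i∣≡i (ℤ.<⇒≤ 0<R)) ⟨
        s ℚ.* fromℤ (+ p ℤ.* + normR) ≡⟨ cong (λ i → s ℚ.* fromℤ i) (ℤ.pos-* p normR) ⟨
        s ℚ.* fromℤ (+ (p ℕ.* normR)) ≡⟨ /-*-cancel (+ 1) (p ℕ.* normR) ⟩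
        1ℚ ∎
        where open ≡-Reasoning

      β=Q/pR : Fraction u v Q₀ Q₁ R₀ R₁
      β=Q/pR = fraction
        (sym (trans (re-conj-cancel τ s pℚ q₀ q₁ r₀ r₁)
          (trans (cong (ℚ._* q₀) sp-norm) (ℚ.*-identityˡ q₀))))
        (sym (trans (im-conj-cancel τ s pℚ q₀ q₁ r₀ r₁)
          (trans (cong (ℚ._* q₁) sp-norm) (ℚ.*-identityˡ q₁))))

      re-one : re u v (x ℚ.- c₀) (y ℚ.- c₁) ≡ 1ℚ
      re-one = begin
        re u v (x ℚ.- c₀) (y ℚ.- c₁)
          ≡⟨ cong₂ (re u v) (remainder-eq x c₀ z₀ F₀.split) (remainder-eq y c₁ z₁ F₁.split) ⟩
        re u v (pℚ ℚ.* z₀) (pℚ ℚ.* z₁) ≡⟨ re-conj τ s pℚ q₀ q₁ r₀ r₁ z₀ z₁ ⟩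
        s ℚ.* pℚ ℚ.* conj₀ τ (re z₀ z₁ q₀ q₁) (im τ z₀ z₁ q₀ q₁) r₀ r₁
          ≡⟨ cong₂ (λ a b → s ℚ.* pℚ ℚ.* conj₀ τ a b r₀ r₁) re≡R₀ im≡R₁ ⟩
        s ℚ.* pℚ ℚ.* conj₀ τ r₀ r₁ r₀ r₁ ≡⟨ cong (s ℚ.* pℚ ℚ.*_) (conj₀-self τ r₀ r₁) ⟩
        s ℚ.* pℚ ℚ.* normℚ τ r₀ r₁ ≡⟨ sp-norm ⟩
        1ℚ ∎
        where open ≡-Reasoning

      im-zero : im τ u v (x ℚ.- c₀) (y ℚ.- c₁) ≡ 0ℚ
      im-zero = begin
        im τ u v (x ℚ.- c₀) (y ℚ.- c₁)
          ≡⟨ cong₂ (im τ u v) (remainder-eq x c₀ z₀ F₀.split) (remainder-eq y c₁ z₁ F₁.split) ⟩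
        im τ u v (pℚ ℚ.* z₀) (pℚ ℚ.* z₁) ≡⟨ im-conj τ s pℚ q₀ q₁ r₀ r₁ z₀ z₁ ⟩
        s ℚ.* pℚ ℚ.* conj₁ (re z₀ z₁ q₀ q₁) (im τ z₀ z₁ q₀ q₁) r₀ r₁
          ≡⟨ cong₂ (λ a b → s ℚ.* pℚ ℚ.* conj₁ a b r₀ r₁) re≡R₀ im≡R₁ ⟩
        s ℚ.* pℚ ℚ.* conj₁ r₀ r₁ r₀ r₁ ≡⟨ cong (s ℚ.* pℚ ℚ.*_) (conj₁-self r₀ r₁) ⟩
        s ℚ.* pℚ ℚ.* 0ℚ ≡⟨ ℚ.*-zeroʳ (s ℚ.* pℚ) ⟩
        0ℚ ∎
        where open ≡-Reasoning

      α↦β : (a +γ b) ↦ fromℚ² u v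
      α↦β = record
        { ⌊α⌋ = fromℚ² c₀ c₁
        ; isFloor = α-floor
        ; inverse = inverse-of-remainder x y c₀ c₁ u v α∼ re-one im-zero
        }

  -- Induction on a strict upper bound n for 10 N(Q) + N(P). It is stated for a general `a +γ b` so
  -- that it covers the given α as well as the constant sequences that follow.
  finite : ∀ n {a b x y P₀ P₁ Q₀ Q₁} → (a +γ b) ≈ fromℚ² x y →
    Fraction x y P₀ P₁ Q₀ Q₁ → + 0 ℤ.< norm t (Q₀ , Q₁) →
    + 10 ℤ.* norm t (Q₀ , Q₁) ℤ.+ norm t (P₀ , P₁) ℤ.< + n → FiniteExpansion (a +γ b)
  -- Impossible, as Q ≠ 0 makes the weighted sum positive.
  finite zero {P₀ = P₀} {P₁} {Q₀} {Q₁} _ _ 0<Q <0 = contradiction (ℤ.<-trans <0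
    (ℤ.+-mono-<-≤ (ℤ.*-monoˡ-<-pos (+ 10) 0<Q) (norm-nonneg γ (P₀ , P₁)))) (ℤ.<-irrefl refl)
  finite (suc n) {a} {b} {x} {y} {P₀} {P₁} {Q₀} {Q₁} α∼ α=P/pQ 0<Q <1+n =
    let N , ix , iy = bounded₂ x y
    in step N (floorOfRational a x N (proj₁ α∼) ix) (floorOfRational b y N (proj₂ α∼) iy)
    where
    step : ∀ N → FloorData a x N → FloorData b y N → FiniteExpansion (a +γ b)
    step N F₀ F₁ = decide ((R₀ ℤ.≟ + 0) ×-dec (R₁ ℤ.≟ + 0))
      where
      open Step {P₀ = P₀} {P₁} {Q₀} {Q₁} α∼ α=P/pQ 0<Q N F₀ F₁
      decide : Dec (R₀ ≡ + 0 × R₁ ≡ + 0) → FiniteExpansion (a +γ b)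
      decide (yes (R₀≡0 , R₁≡0)) = stops R₀≡0 R₁≡0
      decide (no R≢0) = next (fromℚ² u v) α↦β
        (finite n (∼-refl (λ _ → u) , ∼-refl (λ _ → v)) β=Q/pR 0<R
          -- The old value is at most n, so the strictly smaller new one is below n.
          (ℤ.<-≤-trans decrease (ℤ.i<j⇒i≤pred[j] <1+n)))
        where
        0<R = norm-pos γ R₀ R₁ R≢0
        open Next 0<R

  numerator-eq : ∀ x e → fromℤ (+ p ℤ.* (↥ x ℤ.* + e)) ≡ pℚ ℚ.* (x ℚ.* fromℤ (+ (↧ₙ x ℕ.* e)))
  numerator-eq x e = begin
    fromℤ (+ p ℤ.* (↥ x ℤ.* + e))       ≡⟨ fromℤ-* (+ p) (↥ x ℤ.* + e) ⟩
    pℚ ℚ.* fromℤ (↥ x ℤ.* + e)          ≡⟨ cong (pℚ ℚ.*_) (fromℤ-* (↥ x) (+ e)) ⟩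
    pℚ ℚ.* (fromℤ (↥ x) ℚ.* fromℤ (+ e)) ≡⟨ cong (λ w → pℚ ℚ.* (w ℚ.* fromℤ (+ e))) (*-↧ x) ⟨
    pℚ ℚ.* (x ℚ.* fromℤ (+ ↧ₙ x) ℚ.* fromℤ (+ e))
      ≡⟨ cong (pℚ ℚ.*_) (ℚ.*-assoc x (fromℤ (+ ↧ₙ x)) (fromℤ (+ e))) ⟩
    pℚ ℚ.* (x ℚ.* (fromℤ (+ ↧ₙ x) ℚ.* fromℤ (+ e)))
      ≡⟨ cong (λ w → pℚ ℚ.* (x ℚ.* w)) (fromℤ-* (+ ↧ₙ x) (+ e)) ⟨
    pℚ ℚ.* (x ℚ.* fromℤ (+ ↧ₙ x ℤ.* + e)) ≡⟨ cong (λ i → pℚ ℚ.* (x ℚ.* fromℤ i)) (ℤ.pos-* (↧ₙ x) e) ⟨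
    pℚ ℚ.* (x ℚ.* fromℤ (+ (↧ₙ x ℕ.* e))) ∎
    where open ≡-Reasoning

  -- Starts the descent with Q = d, the product of the two denominators, and P = p d α; the extra p
  -- fits the normal form P / (p Q).
  commonDenominator : ∀ x y → ∃₂ λ P₀ P₁ → ∃ λ d → NonZero d × Fraction x y P₀ P₁ (+ d) (+ 0)
  commonDenominator x y =
    + p ℤ.* (↥ x ℤ.* + ↧ₙ y) , + p ℤ.* (↥ y ℤ.* + ↧ₙ x) , d , ℕ.m*n≢0 (↧ₙ x) (↧ₙ y) ,
    fraction
      (trans (numerator-eq x (↧ₙ y)) (cong (pℚ ℚ.*_)
        (solve 2 (λ w y → w := w :- y :* con 0ℚ) refl (x ℚ.* fromℤ (+ d)) y)))
      (trans (numerator-eq y (↧ₙ x)) (cong (pℚ ℚ.*_)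
        (trans (cong (λ n → y ℚ.* fromℤ (+ n)) (ℕ.*-comm (↧ₙ y) (↧ₙ x)))
          (solve 4 (λ w x y t → w := x :* con 0ℚ :+ w :- t :* (y :* con 0ℚ)) refl
            (y ℚ.* fromℤ (+ d)) x y τ))))
    where
    open ℚ-Solver
    d = ↧ₙ x ℕ.* ↧ₙ y

  rational-finite : ∀ α → α ∈ℚ[γ] → FiniteExpansion α
  rational-finite (a +γ b) (x , y , α∼) =
    let P₀ , P₁ , d , d≢0 , α=P/pd = commonDenominator x y
        Φ = + 10 ℤ.* norm t (+ d , + 0) ℤ.+ norm t (P₀ , P₁)
    in finite (suc ℤ.∣ Φ ∣) α∼ α=P/pd
      (norm-pos γ (+ d) (+ 0) λ { (d≡0 , _) → ℕ.≢-nonZero⁻¹ d ⦃ d≢0 ⦄ (ℤ.+-injective d≡0) })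
      (ℤ.≤-<-trans (i≤+∣i∣ Φ) (ℤ.+<+ (ℕ.n<1+n ℤ.∣ Φ ∣)))

-- Oddness of the admissible primes, and the conclusion.

half : ∀ {p γ} → Admissible p γ → ∃ λ h → p ≡ suc (h ℕ.+ h)
half {p} (p≡3[4] eq) = 1 ℕ.+ 2 ℕ.* (p ℕ./ 4) ,
  trans (ℕ.m≡m%n+[m/n]*n p 4) (trans (cong (ℕ._+ p ℕ./ 4 ℕ.* 4) eq)
    (solve 1 (λ q → con 3 :+ q :* con 4 :=
      con 1 :+ ((con 1 :+ con 2 :* q) :+ (con 1 :+ con 2 :* q))) refl (p ℕ./ 4)))
  where open ℕ-Solver
half {p} (p≡5[12] eq) = 2 ℕ.+ 6 ℕ.* (p ℕ./ 12) ,
  trans (ℕ.m≡m%n+[m/n]*n p 12) (trans (cong (ℕ._+ p ℕ./ 12 ℕ.* 12) eq)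
    (solve 1 (λ q → con 5 :+ q :* con 12 :=
      con 1 :+ ((con 2 :+ con 6 :* q) :+ (con 2 :+ con 6 :* q))) refl (p ℕ./ 12)))
  where open ℕ-Solver

proposition12 : ∀ (p : ℕ) (p-prime : Prime p) (γ : Generator) → Admissible p γ →
    let open Extension p p-prime γ in
    ∀ (α : K) → α ∈ℚ[γ] → FiniteExpansion α
proposition12 p p-prime γ admissible =
  let h , p≡1+2h = half admissible
  in Expansions.rational-finite p p-prime h p≡1+2h γ
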